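{- Let $(a,b;c)$ be admissible hypergeometric parameters and let $p$ be a good prime for them. Then the following are equivalent: (i) for some index $j\ge0$, $\tau_j(c-1)>\tau_j(a-1)$ and $\tau_j(c-1)>\tau_j(b-1)$; (ii) ${}_2F_1(a,b;c;z)$ has $p$-adically unbounded coefficients. Moreover, if the coefficients of ${}_2F_1(a,b;c;z)$ are $p$-adically bounded, then they are all $p$-adic integers.
   Context: $(a,b;c)$ rational is admissible if $0<a,b,c<1$ and $c\ne a$, $c\ne b$. A prime $p$ is good if $v_p(a-1)=v_p(b-1)=v_p(c-1)=0$. ${}_2F_1(a,b;c;z)=\sum_{m\ge0}\frac{(a)_m(b)_m}{(c)_m}\frac{z^m}{m!}$ with $(x)_0=1$, $(x)_m=x(x+1)\cdots(x+m-1)$. For a $p$-adic integer $x$ and $j\ge0$, the truncation $\tau_j(x)$ is the unique integer with $0\le\tau_j(x)<p^j$ and $\tau_j(x)\equiv x\pmod{p^j}$. A series with rational coefficients $A_m$ has $p$-adically unbounded coefficients if $\inf_m v_p(A_m)=-\infty$; otherwise its coefficients are $p$-adically bounded. -}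

module Defs where

open import Data.Nat as ℕ using (ℕ; zero; suc; _^_)
open import Data.Nat.Divisibility using (_∣_)
open import Data.Integer as ℤ using (ℤ; +_)
open import Data.Rational using (ℚ; 0ℚ; 1ℚ; _+_; _-_; _*_; _<_; 1/_; ≢-nonZero)
open import Data.Rational.Properties using (_≟_)
import Data.Rational as Q
open import Data.Product using (_×_; ∃; ∃-syntax)
open import Relation.Nullary using (¬_; yes; no)
open import Relation.Binary.PropositionalEquality using (_≢_)

ℕtoℚ : ℕ → ℚ
ℕtoℚ n = (+ n) Q./ 1

-- total inverse (1/0 := 0); only ever applied to nonzero values below
inv : ℚ → ℚ
inv q with q ≟ 0ℚ
... | yes _  = 0ℚ
... | no q≢0 = 1/_ q {{≢-nonZero q≢0}}

poch : ℚ → ℕ → ℚ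
poch x zero    = 1ℚ
poch x (suc m) = poch x m * (x + ℕtoℚ m)

fact : ℕ → ℚ
fact zero    = 1ℚ
fact (suc m) = fact m * ℕtoℚ (suc m)

coeff : ℚ → ℚ → ℚ → ℕ → ℚ
coeff a b c m = (poch a m * poch b m) * inv (poch c m * fact m)

PIntegral : ℕ → ℚ → Set
PIntegral p x = ¬ (p ∣ ℚ.denominatorℕ x)

PUnit : ℕ → ℚ → Set
PUnit p x = ¬ (p ∣ ℤ.∣ ℚ.numerator x ∣) × ¬ (p ∣ ℚ.denominatorℕ x)

Admissible : ℚ → ℚ → ℚ → Set
Admissible a b c =
  (0ℚ < a × a < 1ℚ) × (0ℚ < b × b < 1ℚ) × (0ℚ < c × c < 1ℚ) × c ≢ a × c ≢ b

Good : ℕ → ℚ → ℚ → ℚ → Set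
Good p a b c = PUnit p (a - 1ℚ) × PUnit p (b - 1ℚ) × PUnit p (c - 1ℚ)

-- t = τ_j(x): 0 ≤ t < p^j and x ≡ t (mod p^j), i.e. (x - t)/p^j is a p-adic integer
IsTrunc : ℕ → ℕ → ℚ → ℕ → Set
IsTrunc p j x t = (t ℕ.< p ^ j) × PIntegral p ((x - ℕtoℚ t) * inv (ℕtoℚ (p ^ j)))

CondI : ℕ → ℚ → ℚ → ℚ → Set
CondI p a b c = ∃[ j ] ∃[ ta ] ∃[ tb ] ∃[ tc ]
  (IsTrunc p j (a - 1ℚ) ta × IsTrunc p j (b - 1ℚ) tb × IsTrunc p j (c - 1ℚ) tc
   × ta ℕ.< tc × tb ℕ.< tc)

Unbounded : ℕ → (ℕ → ℚ) → Set
Unbounded p A = ∀ N → ∃[ m ] ¬ PIntegral p (ℕtoℚ (p ^ N) * A m)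

Bounded : ℕ → (ℕ → ℚ) → Set
Bounded p A = ∃[ N ] ∀ m → PIntegral p (ℕtoℚ (p ^ N) * A m)

{-# OPTIONS --safe #-}

-- Write a = A/D, b = B/D, c = C/D over a common denominator D prime to p, and let α_j, β_j, γ_j be the
-- truncations τ_j of a - 1, b - 1, c - 1. Exactly ⌊(m + α_j)/p^j⌋ of the factors A + iD (i < m) of
-- D^m (a)_m are divisible by p^j, so
--   v_p(A_m) = Σ_{j ≥ 1} (⌊(m + α_j)/p^j⌋ + ⌊(m + β_j)/p^j⌋ - ⌊(m + γ_j)/p^j⌋ - ⌊m/p^j⌋).
-- A negative term forces γ_j > α_j and γ_j > β_j, so a non-integral coefficient yields (i).
-- Conversely, descend from a level j as in (i) as far as possible, so that γ_{j-1} ≤ β_{j-1}, say, and take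
-- the largest e < j with γ_e ≤ α_e. For m₀ = p^j + γ_e - γ_j no term is positive and the j-th is negative,
-- because adding m₀ to c - 1 carries at all levels in (e, j], adding it to a - 1 never carries, and adding
-- it to b - 1 does not carry at level j or above. As a - 1, b - 1, c - 1 lie in [-1, 0], their p-adic digits
-- are periodic; repeating the block m₀ N times along a period makes v_p(A_m) ≤ -N.

module Submission where

open import Defs
open import Data.Nat
open import Data.Nat.Properties
open import Data.Nat.Divisibility
open import Data.Nat.DivMod
open import Data.Nat.Coprimality as Coprimality using (Coprime; coprime-divisor)
open import Data.Nat.Primality using (Prime; euclidsLemma; prime⇒irreducible; prime⇒nonZero; prime⇒nonTrivial)
open import Data.Nat.Tactic.RingSolver using (solve-∀)
open import Data.Integer as ℤ using ()
import Data.Integer.Properties as ℤ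
open import Data.Rational as ℚ using (ℚ; 0ℚ; 1ℚ; toℚᵘ; mkℚ)
import Data.Rational.Properties as ℚ
open import Data.Rational.Solver using (module +-*-Solver)
open import Data.Rational.Unnormalised as ℚᵘ using (mkℚᵘ; *≡*)
import Data.Rational.Unnormalised.Properties as ℚᵘ
open import Data.Empty using (⊥-elim)
open import Data.Fin using (toℕ; fromℕ<)
open import Data.Fin.Properties using (pigeonhole; toℕ-fromℕ<)
open import Data.Product using (_×_; _,_; ∃-syntax; proj₁; proj₂)
open import Data.Sum using (_⊎_; inj₁; inj₂; [_,_]′)
open import Function using (_∘_)
open import Function.Bundles using (_⇔_; mk⇔)
open import Relation.Nullary using (¬_; yes; no)
open import Relation.Binary.PropositionalEquality using (_≡_; _≢_; refl; sym; trans; cong; cong₂; subst; subst₂; module ≡-Reasoning)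

-- Finite sums of natural numbers.

∑ : ℕ → (ℕ → ℕ) → ℕ
∑ zero    f = 0
∑ (suc n) f = f 0 + ∑ n (f ∘ suc)

∑-split : ∀ m n f → ∑ (m + n) f ≡ ∑ m f + ∑ n (f ∘ (m +_))
∑-split zero    n f = refl
∑-split (suc m) n f = trans (cong (f 0 +_) (∑-split m n (f ∘ suc))) (sym (+-assoc (f 0) _ _))

∑-mono : ∀ n {f g} → (∀ i → i < n → f i ≤ g i) → ∑ n f ≤ ∑ n g
∑-mono zero    h = z≤n
∑-mono (suc n) h = +-mono-≤ (h 0 z<s) (∑-mono n (λ i i<n → h (suc i) (s<s i<n)))

∑-cong : ∀ n {f g} → (∀ i → i < n → f i ≡ g i) → ∑ n f ≡ ∑ n g
∑-cong n h = ≤-antisym (∑-mono n (λ i l → ≤-reflexive (h i l))) (∑-mono n (λ i l → ≤-reflexive (sym (h i l))))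

∑-mono-< : ∀ n {f g} → (∀ i → i < n → f i ≤ g i) → ∀ k → k < n → f k < g k → ∑ n f < ∑ n g
∑-mono-< (suc n) h zero    _         lt = +-mono-<-≤ lt (∑-mono n (λ i i<n → h (suc i) (s<s i<n)))
∑-mono-< (suc n) h (suc k) (s<s k<n) lt =
  +-mono-≤-< (h 0 z<s) (∑-mono-< n (λ i i<n → h (suc i) (s<s i<n)) k k<n lt)

∑-≡0 : ∀ n {f} → (∀ i → f i ≡ 0) → ∑ n f ≡ 0
∑-≡0 zero    h = refl
∑-≡0 (suc n) h = cong₂ _+_ (h 0) (∑-≡0 n (h ∘ suc))

∑-+ : ∀ n f g → ∑ n (λ i → f i + g i) ≡ ∑ n f + ∑ n g
∑-+ zero    f g = refl
∑-+ (suc n) f g rewrite ∑-+ n (f ∘ suc) (g ∘ suc) = lem (f 0) (g 0) _ _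
  where
  lem : ∀ a b c d → a + b + (c + d) ≡ a + c + (b + d)
  lem = solve-∀

∑-<⇒∃ : ∀ n f g → ∑ n f < ∑ n g → ∃[ i ] i < n × f i < g i
∑-<⇒∃ n f g lt with anyUpTo? (λ i → f i <? g i) n
... | yes p = p
... | no ¬p = ⊥-elim (<⇒≱ lt (∑-mono n (λ i i<n → ≮⇒≥ (λ l → ¬p (i , i<n , l)))))

-- Floors of quotients and divisibility indicators.

/-unique : ∀ r k q .{{_ : NonZero q}} → r < q → (r + k * q) / q ≡ k
/-unique r k q r<q = trans (+-distrib-/-∣ʳ r (n∣m*n k)) (cong₂ _+_ (m<n⇒m/n≡0 r<q) (m*n/n≡m k q))

/-+ : ∀ n k q .{{_ : NonZero q}} → (n + k * q) / q ≡ n / q + k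
/-+ n k q = trans (+-distrib-/-∣ʳ n (n∣m*n k)) (cong (n / q +_) (m*n/n≡m k q))

/-lower : ∀ k {n} q .{{_ : NonZero q}} → k * q ≤ n → k ≤ n / q
/-lower k q le = subst (_≤ _) (m*n/n≡m k q) (/-monoˡ-≤ q le)

/-upper : ∀ k {n} q .{{_ : NonZero q}} → n < suc k * q → n / q ≤ k
/-upper k {n} q lt = s≤s⁻¹ (m<n*o⇒m/o<n {n} {suc k} lt)

indicator∣ : ℕ → ℕ → ℕ
indicator∣ d n with d ∣? n
... | yes _ = 1
... | no  _ = 0

indicator∣-yes : ∀ {d n} → d ∣ n → indicator∣ d n ≡ 1
indicator∣-yes {d} {n} d∣n with d ∣? n
... | yes _  = refl
... | no d∤n = ⊥-elim (d∤n d∣n)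

indicator∣-no : ∀ {d n} → ¬ d ∣ n → indicator∣ d n ≡ 0
indicator∣-no {d} {n} d∤n with d ∣? n
... | yes d∣n = ⊥-elim (d∤n d∣n)
... | no _    = refl

indicator∣-cong : ∀ {d n d′ n′} → (d ∣ n → d′ ∣ n′) → (d′ ∣ n′ → d ∣ n) → indicator∣ d n ≡ indicator∣ d′ n′
indicator∣-cong {d} {n} f g with d ∣? n
... | yes h = sym (indicator∣-yes (f h))
... | no h  = sym (indicator∣-no (h ∘ g))

-- This drives the count of factors divisible by a prime power: the floor moves exactly when a new
-- multiple of `q` is reached.
suc-/ : ∀ n q .{{_ : NonZero q}} → suc n / q ≡ n / q + indicator∣ q (suc n)
suc-/ n q with q ∣? suc n
... | yes (divides zero ())
... | yes (divides (suc k) eq) = trans (trans (cong (_/ q) eq) (m*n/n≡m (suc k) q)) (trans (+-comm 1 k) (cong (_+ 1)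
    (sym n/q≡k)))
  where
  n≡ : n ≡ pred q + k * q
  n≡ = suc-injective (trans eq (cong (_+ k * q) (sym (suc-pred q))))
  n/q≡k : n / q ≡ k
  n/q≡k = trans (cong (_/ q) n≡) (/-unique (pred q) k q (≤-reflexive (suc-pred q)))
... | no q∤ with suc n % q in eq
...   | zero  = ⊥-elim (q∤ (m%n≡0⇒n∣m (suc n) q eq))
...   | suc r = trans (sym (trans (cong (_/ q) n≡) (/-unique r (suc n / q) q (<-trans (n<1+n r) (subst (_< q) eq
    (m%n<n (suc n) q)))))) (sym (+-identityʳ _))
  where
  n≡ : n ≡ r + suc n / q * q
  n≡ = suc-injective (trans (m≡m%n+[m/n]*n (suc n) q) (cong (_+ suc n / q * q) eq))

-- Supplies a cutoff level above which all terms of a valuation formula vanish.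
n<p^n : ∀ p → 1 < p → ∀ n → n < p ^ n
n<p^n p 1<p zero    = z<s
n<p^n p 1<p (suc n) = begin-strict
  suc n       <⟨ s<s (n<p^n p 1<p n) ⟩
  suc (p ^ n) ≤⟨ +-monoˡ-≤ (p ^ n) (≤-trans (s≤s z≤n) (n<p^n p 1<p n)) ⟩
  p ^ n + p ^ n ≡⟨ cong (p ^ n +_) (sym (+-identityʳ _)) ⟩
  2 * p ^ n   ≤⟨ *-monoˡ-≤ (p ^ n) 1<p ⟩
  p * p ^ n   ∎
  where open ≤-Reasoning

-- The p-adic valuation on natural numbers.

module Valuation (p : ℕ) (p-prime : Prime p) where
  instance
    p≢0 : NonZero p
    p≢0 = prime⇒nonZero p-prime

  1<p : 1 < p
  1<p = nonTrivial⇒n>1 p {{prime⇒nonTrivial p-prime}}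

  -- A relation carrying the cofactor prime to `p`; zero has no valuation.
  HasVal : ℕ → ℕ → Set
  HasVal n k = ∃[ u ] n ≡ p ^ k * u × ¬ p ∣ u

  HasVal⇒∣ : ∀ {n k} → HasVal n k → p ^ k ∣ n
  HasVal⇒∣ (u , refl , _) = m∣m*n u

  val-* : ∀ {m n k l} → HasVal m k → HasVal n l → HasVal (m * n) (k + l)
  val-* {k = k} {l} (u , refl , p∤u) (v , refl , p∤v) = u * v , eq , λ p∣ → case (euclidsLemma u v p-prime p∣)
    where
    lem : ∀ a b u v → a * u * (b * v) ≡ a * b * (u * v)
    lem = solve-∀
    eq : p ^ k * u * (p ^ l * v) ≡ p ^ (k + l) * (u * v)
    eq = trans (lem (p ^ k) (p ^ l) u v) (cong (_* (u * v)) (sym (^-distribˡ-+-* p k l)))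
    case : ¬ (p ∣ u ⊎ p ∣ v)
    case (inj₁ x) = p∤u x
    case (inj₂ y) = p∤v y

  val-unit : ∀ {n} → ¬ p ∣ n → HasVal n 0
  val-unit {n} p∤n = n , sym (+-identityʳ n) , p∤n

  val-p^ : ∀ k → HasVal (p ^ k) k
  val-p^ k = 1 , sym (*-identityʳ _) , λ p∣1 → <⇒≱ 1<p (∣⇒≤ p∣1)

  p^∣-cancelʳ : ∀ {D} → ¬ p ∣ D → ∀ j n → p ^ j ∣ n * D → p ^ j ∣ n
  p^∣-cancelʳ p∤D zero    n h = 1∣ n
  p^∣-cancelʳ {D} p∤D (suc j) n h with euclidsLemma n D p-prime (∣-trans (m∣m*n (p ^ j)) h)
  ... | inj₂ p∣D = ⊥-elim (p∤D p∣D)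
  ... | inj₁ (divides e refl) = subst (p ^ suc j ∣_) (*-comm p e)
    (*-monoʳ-∣ p (p^∣-cancelʳ p∤D j e (*-cancelˡ-∣ p (subst (p ^ suc j ∣_) (lem e p D) h))))
    where
    lem : ∀ e p D → e * p * D ≡ p * (e * D)
    lem = solve-∀

  p^-split : ∀ {i j} → i ≤ j → p ^ j ≡ p ^ (j ∸ i) * p ^ i
  p^-split {i} {j} i≤j = trans (cong (p ^_) (sym (m∸n+n≡m i≤j))) (^-distribˡ-+-* p (j ∸ i) i)

  p^-mono-∣ : ∀ {i j} → i ≤ j → p ^ i ∣ p ^ j
  p^-mono-∣ {i} {j} i≤j = divides (p ^ (j ∸ i)) (p^-split i≤j)

  p^∣⇒≤ : ∀ {n k j} → HasVal n k → p ^ j ∣ n → j ≤ k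
  p^∣⇒≤ {k = k} {j} (u , refl , p∤u) h with j ≤? k
  ... | yes j≤k = j≤k
  ... | no j≰k = ⊥-elim (p∤u (subst (_∣ u) (*-identityʳ p) (*-cancelˡ-∣ (p ^ k) {{m^n≢0 p k}} (∣-trans (subst
      (_∣ p ^ j) (trans (*-comm p (p ^ k)) (cong (p ^ k *_) (sym (*-identityʳ p)))) (p^-mono-∣ (≰⇒> j≰k))) h))))

  -- The valuation counts the levels at which a power of `p` divides `n`, and the bound on `n` puts
  -- all of them below the cutoff. Dividing out one `p` shifts the levels by one.
  val-∑ : ∀ J n .{{_ : NonZero n}} → n < p ^ J → HasVal n (∑ J (λ j → indicator∣ (p ^ suc j) n))
  val-∑ zero    (suc n) (s<s ())
  val-∑ (suc J) n n<p^J with p ∣? n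
  ... | no p∤n = subst (HasVal n) (sym (∑-≡0 (suc J) (λ i → indicator∣-no (λ h → p∤n (∣-trans (m∣m*n (p ^ i)) h)))))
      (val-unit p∤n)
  ... | yes (divides n′ refl) = subst₂ HasVal (*-comm p n′) (cong₂ _+_ (sym (indicator∣-yes p^1∣)) (∑-cong J
      (λ i _ → shift (p ^ suc i))))
          (val-* {k = 1} {∑ J (λ j → indicator∣ (p ^ suc j) n′)} (subst (λ x → HasVal x 1) (*-identityʳ p)
              (val-p^ 1)) (val-∑ J n′ {{n′≢0}} n′<))
    where
    p^1∣ : p ^ 1 ∣ n′ * p
    p^1∣ = subst (_∣ n′ * p) (sym (*-identityʳ p)) (n∣m*n n′)
    n′≢0 : NonZero n′
    n′≢0 = m*n≢0⇒m≢0 n′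
    n′< : n′ < p ^ J
    n′< = *-cancelˡ-< p n′ (p ^ J) (subst (_< p ^ suc J) (*-comm n′ p) n<p^J)
    shift : ∀ q → indicator∣ q n′ ≡ indicator∣ (p * q) (n′ * p)
    shift q = indicator∣-cong (λ h → subst (p * q ∣_) (*-comm p n′) (*-monoʳ-∣ p h))
                       (λ h → *-cancelˡ-∣ p (subst (p * q ∣_) (*-comm n′ p) h))

-- Truncations of A/D - 1 in terms of natural numbers.

module Truncation (p : ℕ) (p-prime : Prime p) (D : ℕ) .{{_ : NonZero D}} (p∤D : ¬ p ∣ D) where
  open Valuation p p-prime

  -- Trunc A j t says that t = τ_j(A/D - 1): the witness s satisfies (A/D - 1) - t = -(s/D) p^j.
  Trunc : ℕ → ℕ → ℕ → Set
  Trunc A j t = t < p ^ j × ∃[ s ] A + s * p ^ j ≡ suc t * D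

  -- Subtracting the two equations shows that `p ^ j` divides `(t′ ∸ t) * D`; as `p` does not divide
  -- `D`, it divides `t′ ∸ t`, which is less than `p ^ j`.
  trunc-≤ : ∀ {A j t t′} → Trunc A j t → Trunc A j t′ → t ≤ t′ → t ≡ t′
  trunc-≤ {A} {j} {t} {t′} (_ , s , eq) (t′<q , s′ , eq′) t≤t′ = trans (sym (+-identityʳ t)) (trans (cong (t +_)
      (sym d≡0)) t+d≡t′)
    where
    q = p ^ j
    d = t′ ∸ t
    t+d≡t′ : t + d ≡ t′
    t+d≡t′ = m+[n∸m]≡n t≤t′
    lem : ∀ t d D → suc (t + d) * D ≡ suc t * D + d * D
    lem = solve-∀
    s′q≡ : s′ * q ≡ s * q + d * D
    s′q≡ = +-cancelˡ-≡ A _ _ (begin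
      A + s′ * q          ≡⟨ eq′ ⟩
      suc t′ * D          ≡⟨ cong (λ x → suc x * D) (sym t+d≡t′) ⟩
      suc (t + d) * D     ≡⟨ lem t d D ⟩
      suc t * D + d * D   ≡⟨ cong (_+ d * D) (sym eq) ⟩
      A + s * q + d * D   ≡⟨ +-assoc A _ _ ⟩
      A + (s * q + d * D) ∎)
      where open ≡-Reasoning
    q∣d : q ∣ d
    q∣d = p^∣-cancelʳ p∤D j d (∣m+n∣m⇒∣n (subst (q ∣_) s′q≡ (n∣m*n s′)) (n∣m*n s))
    d≡0 : d ≡ 0
    d≡0 with d in deq
    ... | zero  = refl
    ... | suc _ = ⊥-elim (<⇒≱ (≤-<-trans (m∸n≤m t′ t) t′<q) (subst (q ≤_) (sym deq) (∣⇒≤ (subst (q ∣_) deq q∣d))))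

  trunc-unique : ∀ {A j t t′} → Trunc A j t → Trunc A j t′ → t ≡ t′
  trunc-unique {A} {j} {t} {t′} T T′ with ≤-total t t′
  ... | inj₁ t≤t′ = trunc-≤ {A} {j} T T′ t≤t′
  ... | inj₂ t′≤t = sym (trunc-≤ {A} {j} T′ T t′≤t)

  -- The case of the number 0 = D/D - 1, through which the factorial is treated as one more
  -- Pochhammer symbol.
  trunc-D : ∀ j → Trunc D j 0
  trunc-D j = m^n>0 p j , 0 , refl

  expand : ∀ m t D → suc (m + t) * D ≡ suc t * D + m * D
  expand = solve-∀

  -- Modulo `p ^ j`, `A + m * D` is congruent to `suc (m + t) * D`; the converse below cancels `D`.
  trunc-∣ : ∀ {A j t} → Trunc A j t → ∀ m → p ^ j ∣ suc (m + t) → p ^ j ∣ A + m * D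
  trunc-∣ {A} {j} {t} (_ , s , eq) m h = ∣m+n∣m⇒∣n (subst (p ^ j ∣_) lem (∣m⇒∣m*n D h)) (n∣m*n s)
    where
    lem : suc (m + t) * D ≡ s * p ^ j + (A + m * D)
    lem = begin
      suc (m + t) * D         ≡⟨ expand m t D ⟩
      suc t * D + m * D       ≡⟨ cong (_+ m * D) (sym eq) ⟩
      A + s * p ^ j + m * D   ≡⟨ comm A (s * p ^ j) (m * D) ⟩
      s * p ^ j + (A + m * D) ∎
      where
      open ≡-Reasoning
      comm : ∀ a b c → a + b + c ≡ b + (a + c)
      comm = solve-∀

  trunc-∣⁻ : ∀ {A j t} → Trunc A j t → ∀ m → p ^ j ∣ A + m * D → p ^ j ∣ suc (m + t)
  trunc-∣⁻ {A} {j} {t} (_ , s , eq) m h = p^∣-cancelʳ p∤D j _ (subst (p ^ j ∣_) lem (∣m∣n⇒∣m+n h (n∣m*n s)))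
    where
    lem : A + m * D + s * p ^ j ≡ suc (m + t) * D
    lem = begin
      A + m * D + s * p ^ j   ≡⟨ comm A (m * D) (s * p ^ j) ⟩
      A + s * p ^ j + m * D   ≡⟨ cong (_+ m * D) eq ⟩
      suc t * D + m * D       ≡⟨ expand m t D ⟨
      suc (m + t) * D         ∎
      where
      open ≡-Reasoning
      comm : ∀ a b c → a + b + c ≡ a + c + b
      comm = solve-∀

  -- Reducing the equation modulo `p ^ e` leaves `suc r * D ∸ A` as a multiple of `p ^ e`. `A ≤ D`
  -- makes this a true difference, so the new witness is a natural number.
  trunc-% : ∀ {A e i t} → A ≤ D → e ≤ i → Trunc A i t → Trunc A e (_%_ t (p ^ e) {{m^n≢0 p e}})
  trunc-% {A} {e} {i} {t} A≤D e≤i (_ , s , eq) = m%n<n t q , s″ , (begin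
      A + s″ * q                ≡⟨ cong (A +_) (sym x≡) ⟩
      A + x                     ≡⟨ A+x≡ ⟩
      suc r * D                 ∎)
    where
    open ≡-Reasoning
    q = p ^ e
    instance
      q≢0 : NonZero q
      q≢0 = m^n≢0 p e
    r = t % q
    w = t / q
    x = suc r * D ∸ A
    A+x≡ : A + x ≡ suc r * D
    A+x≡ = m+[n∸m]≡n (≤-trans A≤D (m≤m+n D (r * D)))
    split : s * p ^ i ≡ w * q * D + x
    split = +-cancelˡ-≡ A _ _ (begin
      A + s * p ^ i           ≡⟨ eq ⟩
      suc t * D               ≡⟨ cong (λ z → suc z * D) (m≡m%n+[m/n]*n t q) ⟩
      suc (r + w * q) * D     ≡⟨ lem r (w * q) D ⟩
      w * q * D + suc r * D   ≡⟨ cong (w * q * D +_) (sym A+x≡) ⟩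
      w * q * D + (A + x)     ≡⟨ comm (w * q * D) A x ⟩
      A + (w * q * D + x)     ∎)
      where
      lem : ∀ r v D → suc (r + v) * D ≡ v * D + suc r * D
      lem = solve-∀
      comm : ∀ a b c → a + (b + c) ≡ b + (a + c)
      comm = solve-∀
    q∣x : q ∣ x
    q∣x = ∣m+n∣m⇒∣n (subst (q ∣_) split (∣n⇒∣m*n s (p^-mono-∣ e≤i))) (n∣m*n*o w D)
    s″ = quotient q∣x
    x≡ : x ≡ s″ * q
    x≡ = m∣n⇒n≡quotient*m q∣x

  -- Powers of p modulo D and the periodicity of truncations.

  D∣p*⇒D∣ : ∀ y → D ∣ p * y → D ∣ y
  D∣p*⇒D∣ y = coprime-divisor cop
    where
    cop : Coprime D p
    cop (d∣D , d∣p) with prime⇒irreducible p-prime d∣p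
    ... | inj₁ d≡1 = d≡1
    ... | inj₂ refl = ⊥-elim (p∤D d∣D)

  D∣p^*⇒D∣ : ∀ i y → D ∣ p ^ i * y → D ∣ y
  D∣p^*⇒D∣ zero    y h = subst (D ∣_) (+-identityʳ y) h
  D∣p^*⇒D∣ (suc i) y h = D∣p^*⇒D∣ i y (D∣p*⇒D∣ _ (subst (D ∣_) (*-assoc p (p ^ i) y) h))

  -- Thus `L` is a multiple of the order of `p` modulo `D`. The quotient `K` is kept because it
  -- gives the repeating digit block `(D ∸ A) * K`.
  Period : ℕ → Set
  Period L = ∃[ K ] p ^ L ≡ 1 + K * D

  %-≡⇒∣∸ : ∀ m n → m % D ≡ n % D → D ∣ n ∸ m
  %-≡⇒∣∸ m n eq = subst (D ∣_) (sym (begin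
      n ∸ m ≡⟨ cong₂ _∸_ (m≡m%n+[m/n]*n n D) (trans (m≡m%n+[m/n]*n m D) (cong (_+ m / D * D) eq)) ⟩
      (n % D + n / D * D) ∸ (n % D + m / D * D) ≡⟨ [m+n]∸[m+o]≡n∸o (n % D) _ _ ⟩
      n / D * D ∸ m / D * D ≡⟨ *-distribʳ-∸ D (n / D) (m / D) ⟨
      (n / D ∸ m / D) * D ∎)) (n∣m*n (n / D ∸ m / D))
    where open ≡-Reasoning

  -- Two of the powers with exponents 0 to `D` agree modulo `D`, and the smaller one can be
  -- cancelled since `p` is prime to `D`.
  period : ∃[ M ] 1 ≤ M × Period M
  period with pigeonhole (n<1+n D) (λ i → fromℕ< (m%n<n (p ^ toℕ i) D))
  ... | i , j , i<j , eq = toℕ j ∸ toℕ i , m<n⇒0<n∸m i<j , quotient D∣ , trans (sym (m+[n∸m]≡n (m^n>0 p M)))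
      (cong suc (m∣n⇒n≡quotient*m D∣))
    where
    M = toℕ j ∸ toℕ i
    eq′ : p ^ toℕ i % D ≡ p ^ toℕ j % D
    eq′ = trans (sym (toℕ-fromℕ< _)) (trans (cong toℕ eq) (toℕ-fromℕ< _))
    factor : p ^ toℕ j ∸ p ^ toℕ i ≡ p ^ toℕ i * (p ^ M ∸ 1)
    factor = sym (trans (*-distribˡ-∸ (p ^ toℕ i) (p ^ M) 1) (cong₂ _∸_ (trans (*-comm (p ^ toℕ i) (p ^ M)) (sym
        (p^-split (<⇒≤ i<j)))) (*-identityʳ (p ^ toℕ i))))
    D∣ : D ∣ p ^ M ∸ 1
    D∣ = D∣p^*⇒D∣ (toℕ i) _ (subst (D ∣_) factor (%-≡⇒∣∸ _ _ eq′))

  period-* : ∀ {M} → Period M → ∀ n → Period (n * M)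
  period-* _ zero = 0 , refl
  period-* {M} P@(K , eq) (suc n) with period-* P n
  ... | K′ , eq′ = K + K′ + K * D * K′ , (begin
      p ^ (M + n * M)           ≡⟨ ^-distribˡ-+-* p M (n * M) ⟩
      p ^ M * p ^ (n * M)       ≡⟨ cong₂ _*_ eq eq′ ⟩
      (1 + K * D) * (1 + K′ * D) ≡⟨ lem K K′ D ⟩
      1 + (K + K′ + K * D * K′) * D ∎)
    where
    open ≡-Reasoning
    lem : ∀ x y d → (1 + x * d) * (1 + y * d) ≡ 1 + (x + y + x * d * y) * d
    lem = solve-∀

  period-≥ : ∀ j → ∃[ L ] j ≤ L × Period L
  period-≥ j with period
  ... | M , 1≤M , P = j * M , subst (_≤ j * M) (*-identityʳ j) (*-monoʳ-≤ j 1≤M) , period-* P j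

  -- With p^L = 1 + K D, the number A/D - 1 = -(D - A)/D is the geometric series (D - A) K (1 + p^L + p^2L + ...).
  trunc-period : ∀ {A L} → 0 < A → A ≤ D → ((K , _) : Period L) → (D ∸ A) * K < p ^ L × A + (D ∸ A) * p ^ L ≡ suc
      ((D ∸ A) * K) * D
  trunc-period {A} {L} 0<A A≤D (K , eq) = BK< , (begin
      A + B * p ^ L        ≡⟨ cong (λ z → A + B * z) eq ⟩
      A + B * (1 + K * D)  ≡⟨ lem A B K D ⟩
      A + B + B * K * D    ≡⟨ cong (_+ B * K * D) (m+[n∸m]≡n A≤D) ⟩
      D + B * K * D ∎)
    where
    open ≡-Reasoning
    B = D ∸ A
    lem : ∀ A B K D → A + B * (1 + K * D) ≡ A + B + B * K * D
    lem = solve-∀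
    BK< : B * K < p ^ L
    BK< = subst (B * K <_) (sym eq) (s≤s (≤-trans (*-monoˡ-≤ K (m∸n≤m D A)) (≤-reflexive (*-comm D K))))

  -- At a period `L ≥ j` the truncation is explicit; it is then reduced modulo `p ^ j`.
  trunc-∃ : ∀ {A} → 0 < A → A ≤ D → ∀ j → ∃[ t ] Trunc A j t
  trunc-∃ {A} 0<A A≤D j with period-≥ j
  ... | L , j≤L , P with trunc-period {A} {L} 0<A A≤D P
  ... | lt , eq = _ , trunc-% A≤D j≤L (lt , D ∸ A , eq)

  -- With x = A/D - 1 and `t` its truncation at a period, x = t + p^L x. Hence the digits of x above
  -- level `L` are again those of x.
  trunc-shift : ∀ {A L i t t′} → 0 < A → A ≤ D → Period L → Trunc A L t → Trunc A i t′ → Trunc A (L + i)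
      (t + t′ * p ^ L)
  trunc-shift {A} {L} {i} {t} {t′} 0<A A≤D P T (t′<q , s , eq) with trunc-period {A} {L} 0<A A≤D P
  -- Uniqueness identifies `t` with the explicit block `(D ∸ A) * K`.
  ... | lt , eqL with trunc-unique {A} {L} T (lt , D ∸ A , eqL)
  ... | refl = bound , s , (begin
      A + s * p ^ (L + i)      ≡⟨ cong (λ z → A + s * z) (^-distribˡ-+-* p L i) ⟩
      A + s * (p ^ L * p ^ i)  ≡⟨ lem₁ A s (p ^ L) (p ^ i) ⟩
      A + s * p ^ i * p ^ L    ≡⟨ cong (λ z → A + z * p ^ L) sp^i≡ ⟩
      A + (B + t′ * D) * p ^ L ≡⟨ lem₂ A B t′ D (p ^ L) ⟩
      A + B * p ^ L + t′ * D * p ^ L ≡⟨ cong (_+ t′ * D * p ^ L) eqL ⟩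
      suc t * D + t′ * D * p ^ L     ≡⟨ lem₃ t t′ D (p ^ L) ⟩
      suc (t + t′ * p ^ L) * D ∎)
    where
    open ≡-Reasoning
    B = D ∸ A
    lem₁ : ∀ A s x y → A + s * (x * y) ≡ A + s * y * x
    lem₁ = solve-∀
    lem₂ : ∀ A B t D x → A + (B + t * D) * x ≡ A + B * x + t * D * x
    lem₂ = solve-∀
    lem₃ : ∀ t u D x → suc t * D + u * D * x ≡ suc (t + u * x) * D
    lem₃ = solve-∀
    sp^i≡ : s * p ^ i ≡ B + t′ * D
    sp^i≡ = +-cancelˡ-≡ A _ _ (trans eq (trans (cong (_+ t′ * D) (sym (m+[n∸m]≡n A≤D))) (+-assoc A B _)))
    bound : t + t′ * p ^ L < p ^ (L + i)
    bound = <-≤-trans (+-monoˡ-< (t′ * p ^ L) lt) (≤-trans (*-monoˡ-≤ (p ^ L) t′<q)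
      (≤-reflexive (trans (*-comm (p ^ i) (p ^ L)) (sym (^-distribˡ-+-* p L i)))))

-- Carries, and the construction of a block.

module Windows (p : ℕ) (p-prime : Prime p) where
  open Valuation p p-prime

  -- Such a sequence is a p-adic integer, given by its truncations at all levels.
  record Coherent (α : ℕ → ℕ) : Set where
    field
      bound  : ∀ i → α i < p ^ i
      compat : ∀ {e i} → e ≤ i → ∃[ w ] α i ≡ α e + w * p ^ e

    mono : ∀ {e i} → e ≤ i → α e ≤ α i
    mono e≤i with compat e≤i
    ... | w , eq = subst (α _ ≤_) (sym eq) (m≤m+n (α _) _)

    base : α 0 ≡ 0
    base = n<1⇒n≡0 (bound 0)

  -- With α i = τ_i(x), this exceeds ⌊m/p^i⌋ by the carry into the i-th digit when m is added to x.
  G : (ℕ → ℕ) → ℕ → ℕ → ℕ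
  G α m i = _/_ (m + α i) (p ^ i) {{m^n≢0 p i}}

  -- the truncations of 0, which account for m! = (1)_m
  𝟎 : ℕ → ℕ
  𝟎 _ = 0

  G-lower : ∀ α m k i → k * p ^ i ≤ m + α i → k ≤ G α m i
  G-lower _ _ k i = /-lower k (p ^ i) {{m^n≢0 p i}}

  G-upper : ∀ α m k i → m + α i < suc k * p ^ i → G α m i ≤ k
  G-upper _ _ k i = /-upper k (p ^ i) {{m^n≢0 p i}}

  -- The digits from level `e` upward must form a smaller number `w` for `α` than `v` for `γ`, as
  -- the lower parts compare the other way. One unit of `p ^ e` then exceeds `α e`.
  gap : ∀ {α γ} → Coherent α → Coherent γ → ∀ {e i} → e ≤ i → γ e ≤ α e → α i < γ i → α i + γ e < γ i
  gap {α} {γ} cα cγ {e} {i} e≤i γe≤αe αi<γi with Coherent.compat cα e≤i | Coherent.compat cγ e≤i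
  ... | w , αi≡ | v , γi≡ with v ≤? w
  ... | yes v≤w = ⊥-elim (<⇒≱ αi<γi (subst₂ _≤_ (sym γi≡) (sym αi≡) (+-mono-≤ γe≤αe (*-monoˡ-≤ (p ^ e) v≤w))))
  ... | no v≰w = begin-strict
      α i + γ e              ≡⟨ cong (_+ γ e) αi≡ ⟩
      α e + w * p ^ e + γ e  <⟨ +-monoˡ-< (γ e) (+-monoˡ-< (w * p ^ e) (Coherent.bound cα e)) ⟩
      suc w * p ^ e + γ e    ≤⟨ +-monoˡ-≤ (γ e) (*-monoˡ-≤ (p ^ e) (≰⇒> v≰w)) ⟩
      v * p ^ e + γ e        ≡⟨ +-comm _ (γ e) ⟩
      γ e + v * p ^ e        ≡⟨ γi≡ ⟨
      γ i ∎
    where open ≤-Reasoning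

  -- `levels` and `strict` make every valuation term of `m₀` nonpositive and the j-th negative. The
  -- top conditions exclude carries out of the block, so that copies can be stacked.
  record Block (α β γ : ℕ → ℕ) (j : ℕ) : Set where
    field
      m₀     : ℕ
      1≤j    : 1 ≤ j
      levels : ∀ i → G α m₀ i + G β m₀ i ≤ G γ m₀ i + G 𝟎 m₀ i
      strict : G α m₀ j + G β m₀ j < G γ m₀ j + G 𝟎 m₀ j
      α-top  : ∀ {i} → j ≤ i → m₀ + α i < p ^ i
      β-top  : ∀ {i} → j ≤ i → m₀ + β i < p ^ i

  -- The sum stays within the lowest `j` digits, so the digits above, collected in `w`, are
  -- unchanged.
  no-carry : ∀ {α m j} → Coherent α → m + α j < p ^ j → ∀ {i} → j ≤ i → m + α i < p ^ i
  no-carry {α} {m} {j} cα lt {i} j≤i with Coherent.compat cα j≤i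
  ... | w , αi≡ = begin-strict
      m + α i                ≡⟨ cong (m +_) αi≡ ⟩
      m + (α j + w * p ^ j)  ≡⟨ sym (+-assoc m _ _) ⟩
      m + α j + w * p ^ j    <⟨ +-monoˡ-< (w * p ^ j) lt ⟩
      suc w * p ^ j          ≤⟨ *-monoˡ-≤ (p ^ j) w< ⟩
      p ^ (i ∸ j) * p ^ j    ≡⟨ p^-split j≤i ⟨
      p ^ i ∎
    where
    open ≤-Reasoning
    w< : w < p ^ (i ∸ j)
    w< = *-cancelʳ-< (p ^ j) w (p ^ (i ∸ j)) (≤-<-trans (≤-trans (m≤n+m _ (α j)) (≤-reflexive (sym αi≡))) (subst
        (α i <_) (p^-split j≤i) (Coherent.bound cα i)))

  block : ∀ {α β γ} → Coherent α → Coherent β → Coherent γ → ∀ {e k} → e ≤ k →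
    γ e ≤ α e → (∀ i → e < i → i ≤ suc k → α i < γ i) →
    γ k ≤ β k → β (suc k) < γ (suc k) → Block α β γ (suc k)
  block {α} {β} {γ} cα cβ cγ {e} {k} e≤k γe≤αe α<γ γk≤βk βj<γj = record
    { m₀ = m₀ ; 1≤j = s≤s z≤n ; levels = levels ; strict = strict
    ; α-top = no-carry cα α-top ; β-top = no-carry cβ β-top }
    where
    module γ = Coherent cγ
    j = suc k
    e≤j = m≤n⇒m≤1+n e≤k
    -- Chosen so that adding `m₀` to `γ j` carries out at level `j` and leaves exactly `γ e`.
    m₀ = p ^ j + γ e ∸ γ j
    m₀+γj : m₀ + γ j ≡ p ^ j + γ e
    m₀+γj = m∸n+n≡m (≤-trans (<⇒≤ (γ.bound j)) (m≤m+n _ _))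
    top : ∀ {x} → x + γ e < γ j → m₀ + x < p ^ j
    top {x} lt = +-cancelʳ-< (γ e) (m₀ + x) (p ^ j) (begin-strict
      m₀ + x + γ e   ≡⟨ +-assoc m₀ x _ ⟩
      m₀ + (x + γ e) <⟨ +-monoʳ-< m₀ lt ⟩
      m₀ + γ j       ≡⟨ m₀+γj ⟩
      p ^ j + γ e    ∎)
      where open ≤-Reasoning
    α-top : m₀ + α j < p ^ j
    α-top = top (gap cα cγ e≤j γe≤αe (α<γ j (s≤s e≤k) ≤-refl))
    β-top : m₀ + β j < p ^ j
    -- `gap` applies to `β` at level `k` only; `γ e ≤ γ k` then gives the bound with `γ e`.
    β-top = top (≤-<-trans (+-monoʳ-≤ (β j) (γ.mono e≤k)) (gap cβ cγ (n≤1+n k) γk≤βk βj<γj))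

    -- Removing the digits `w` of `γ j` above level `i` from `m₀ + γ j ≡ p ^ j + γ e` leaves a
    -- positive multiple of `p ^ i`, because `w < p ^ (j ∸ i)`.
    mid : ∀ i → e < i → i ≤ j → ∃[ v ] m₀ + γ i ≡ suc v * p ^ i + γ e
    mid i e<i i≤j with γ.compat i≤j
    ... | w , γj≡ = v , +-cancelʳ-≡ (w * p ^ i) _ _ (begin
        m₀ + γ i + w * p ^ i          ≡⟨ +-assoc m₀ _ _ ⟩
        m₀ + (γ i + w * p ^ i)        ≡⟨ cong (m₀ +_) (sym γj≡) ⟩
        m₀ + γ j                      ≡⟨ m₀+γj ⟩
        p ^ j + γ e                   ≡⟨ cong (_+ γ e) (p^-split i≤j) ⟩
        p ^ (j ∸ i) * p ^ i + γ e     ≡⟨ cong (λ z → z * p ^ i + γ e) (sym (m+[n∸m]≡n w<)) ⟩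
        (suc w + v) * p ^ i + γ e     ≡⟨ lem w v (p ^ i) (γ e) ⟩
        suc v * p ^ i + γ e + w * p ^ i ∎)
      where
      open ≡-Reasoning
      v = p ^ (j ∸ i) ∸ suc w
      w< : w < p ^ (j ∸ i)
      w< = *-cancelʳ-< (p ^ i) w (p ^ (j ∸ i)) (≤-<-trans (≤-trans (m≤n+m _ (γ i)) (≤-reflexive (sym γj≡))) (subst
          (γ j <_) (p^-split i≤j) (γ.bound j)))
      lem : ∀ w v q g → (suc w + v) * q + g ≡ suc v * q + g + w * q
      lem = solve-∀

    -- The floor is at least `suc v` for `γ`, at least `v` for `𝟎`, at most `v` where `gap` holds,
    -- and at most `suc v` always. Since `gap` holds for `α` on (e, j], the two sides are separated
    -- by `v + suc v`.
    module Mid (i : ℕ) (e<i : e < i) (v : ℕ) (eq : m₀ + γ i ≡ suc v * p ^ i + γ e) where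
      open ≤-Reasoning
      γ-carries : suc v ≤ G γ m₀ i
      γ-carries = G-lower γ m₀ (suc v) i (subst (suc v * p ^ i ≤_) (sym eq) (m≤m+n _ _))
      𝟎-lower : v ≤ G 𝟎 m₀ i
      𝟎-lower = G-lower 𝟎 m₀ v i (subst (v * p ^ i ≤_) (sym (+-identityʳ m₀)) (+-cancelʳ-≤ (γ i) _ _ (begin
        v * p ^ i + γ i     ≤⟨ +-monoʳ-≤ (v * p ^ i) (<⇒≤ (γ.bound i)) ⟩
        v * p ^ i + p ^ i   ≡⟨ +-comm (v * p ^ i) _ ⟩
        suc v * p ^ i       ≤⟨ m≤m+n _ (γ e) ⟩
        suc v * p ^ i + γ e ≡⟨ eq ⟨
        m₀ + γ i ∎)))
      not-carry : ∀ δ → δ i + γ e < γ i → G δ m₀ i ≤ v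
      not-carry δ lt = G-upper δ m₀ v i (+-cancelʳ-< (γ e) _ _ (begin-strict
        m₀ + δ i + γ e      ≡⟨ +-assoc m₀ _ _ ⟩
        m₀ + (δ i + γ e)    <⟨ +-monoʳ-< m₀ lt ⟩
        m₀ + γ i            ≡⟨ eq ⟩
        suc v * p ^ i + γ e ∎))
      any-upper : ∀ {δ} → Coherent δ → G δ m₀ i ≤ suc v
      any-upper {δ} cδ = G-upper δ m₀ (suc v) i (begin-strict
        m₀ + δ i              <⟨ +-monoʳ-< m₀ (Coherent.bound cδ i) ⟩
        m₀ + p ^ i            ≤⟨ +-monoˡ-≤ (p ^ i) m₀≤ ⟩
        suc v * p ^ i + p ^ i ≡⟨ +-comm _ (p ^ i) ⟩
        suc (suc v) * p ^ i   ∎)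
        where
        m₀≤ : m₀ ≤ suc v * p ^ i
        m₀≤ = +-cancelʳ-≤ (γ e) _ _ (≤-trans (+-monoʳ-≤ m₀ (γ.mono (<⇒≤ e<i))) (≤-reflexive eq))

    strict : G α m₀ j + G β m₀ j < G γ m₀ j + G 𝟎 m₀ j
    strict with mid j (s≤s e≤k) ≤-refl
    -- At level `j` the gap holds for `β` too, so the left side is at most `v + v`.
    ... | v , eq = ≤-trans (s≤s (+-mono-≤ (M.not-carry α (gap cα cγ e≤j γe≤αe (α<γ j (s≤s e≤k) ≤-refl)))
                                    (M.not-carry β (≤-<-trans (+-monoʳ-≤ (β j) (γ.mono e≤k)) (gap cβ cγ
                                        (n≤1+n k) γk≤βk βj<γj)))))
                            (+-mono-≤ M.γ-carries M.𝟎-lower)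
      where module M = Mid j (s≤s e≤k) v eq

    -- `γ j` and `γ e` agree modulo `p ^ e`, which also divides `p ^ j`.
    p^e∣m₀ : p ^ e ∣ m₀
    p^e∣m₀ with γ.compat e≤j
    ... | w , γj≡ = ∣m+n∣m⇒∣n (subst (p ^ e ∣_) (sym eq) (p^-mono-∣ e≤j)) (n∣m*n w)
      where
      open ≡-Reasoning
      lem : ∀ m w g → w + m + g ≡ m + (g + w)
      lem = solve-∀
      eq : w * p ^ e + m₀ ≡ p ^ j
      eq = +-cancelʳ-≡ (γ e) _ _ (trans (lem m₀ (w * p ^ e) (γ e)) (trans (cong (m₀ +_) (sym γj≡)) m₀+γj))

    levels : ∀ i → G α m₀ i + G β m₀ i ≤ G γ m₀ i + G 𝟎 m₀ i
    levels i with i ≤? e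
    -- Here `p ^ i` divides `m₀` and all truncations are below `p ^ i`, so the four floors coincide.
    ... | yes i≤e = ≤-reflexive (cong₂ _+_ (trans (same cα) (sym (same cγ)))
                      (trans (same cβ) (sym (trans (cong (λ z → _/_ z (p ^ i) {{m^n≢0 p i}}) (+-comm m₀ 0)) (at
                          (m^n>0 p i))))))
      where
      d : p ^ i ∣ m₀
      d = ∣-trans (p^-mono-∣ i≤e) p^e∣m₀
      at : ∀ {x} → x < p ^ i → _/_ (x + m₀) (p ^ i) {{m^n≢0 p i}} ≡ quotient d
      at {x} x< = trans (cong (λ z → _/_ (x + z) (p ^ i) {{m^n≢0 p i}}) (m∣n⇒n≡quotient*m d)) (/-unique x
          (quotient d) (p ^ i) {{m^n≢0 p i}} x<)
      same : ∀ {δ} → Coherent δ → G δ m₀ i ≡ quotient d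
      same {δ} cδ = trans (cong (λ z → _/_ z (p ^ i) {{m^n≢0 p i}}) (+-comm m₀ (δ i))) (at (Coherent.bound cδ i))
    ... | no i≰e with i ≤? j
    ...   | yes i≤j with mid i (≰⇒> i≰e) i≤j
    ...     | v , eq = ≤-trans (+-mono-≤ (M.not-carry α (gap cα cγ (<⇒≤ (≰⇒> i≰e)) γe≤αe (α<γ i (≰⇒> i≰e) i≤j)))
        (M.any-upper cβ))
                         (subst (_≤ G γ m₀ i + G 𝟎 m₀ i) (+-comm (suc v) v) (+-mono-≤ M.γ-carries M.𝟎-lower))
      where module M = Mid i (≰⇒> i≰e) v eq
    levels i | no i≰e | no i≰j = ≤-trans (+-mono-≤ (zer α (no-carry cα α-top (<⇒≤ (≰⇒> i≰j)))) (zer β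
        (no-carry cβ β-top (<⇒≤ (≰⇒> i≰j))))) z≤n
      where
      zer : ∀ δ → m₀ + δ i < p ^ i → G δ m₀ i ≤ 0
      zer δ lt = G-upper δ m₀ 0 i (subst (m₀ + δ i <_) (sym (+-identityʳ _)) lt)

  Block-comm : ∀ {α β γ j} → Block α β γ j → Block β α γ j
  Block-comm {α} {β} {γ} {j} B = record
    { m₀ = m₀ ; 1≤j = 1≤j
    ; levels = λ i → subst (_≤ G γ m₀ i + G 𝟎 m₀ i) (+-comm (G α m₀ i) (G β m₀ i)) (levels i)
    ; strict = subst (_< G γ m₀ j + G 𝟎 m₀ j) (+-comm (G α m₀ j) (G β m₀ j)) strict
    ; α-top = β-top ; β-top = α-top }
    where open Block B

  -- The last level up to `k` at which `γ` does not exceed `α`. Level 0 always qualifies, both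
  -- truncations being 0 there.
  descend : ∀ {α γ} → Coherent α → Coherent γ → ∀ k → ∃[ e ] e ≤ k × γ e ≤ α e × (∀ i → e < i → i ≤ k → α i < γ i)
  descend {α} {γ} cα cγ zero = 0 , z≤n , ≤-reflexive (trans (Coherent.base cγ) (sym (Coherent.base cα))) ,
      λ i 0<i i≤0 → ⊥-elim (<⇒≱ 0<i i≤0)
  descend {α} {γ} cα cγ (suc k) with γ (suc k) ≤? α (suc k)
  ... | yes le = suc k , ≤-refl , le , λ i lt le → ⊥-elim (<⇒≱ lt le)
  ... | no ≰ with descend cα cγ k
  ...   | e , e≤k , γe≤αe , f = e , m≤n⇒m≤1+n e≤k , γe≤αe , g
    where
    g : ∀ i → e < i → i ≤ suc k → α i < γ i
    g i e<i i≤ with m≤n⇒m<n∨m≡n i≤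
    ... | inj₁ i<  = f i e<i (s≤s⁻¹ i<)
    ... | inj₂ refl = ≰⇒> ≰

  block-∃-at : ∀ {α β γ} → Coherent α → Coherent β → Coherent γ → ∀ k → α (suc k) < γ (suc k) → β (suc k) < γ
      (suc k) → γ k ≤ β k → Block α β γ (suc k)
  block-∃-at {α} {β} {γ} cα cβ cγ k αj<γj βj<γj γk≤βk with descend cα cγ k
  ... | e , e≤k , γe≤αe , f = block cα cβ cγ e≤k γe≤αe g γk≤βk βj<γj
    where
    g : ∀ i → e < i → i ≤ suc k → α i < γ i
    g i e<i i≤ with m≤n⇒m<n∨m≡n i≤
    ... | inj₁ i<  = f i e<i (s≤s⁻¹ i<)
    ... | inj₂ refl = αj<γj

  -- Lower the level while `γ` exceeds both sequences. This must stop, since all truncations vanish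
  -- at level 0; whichever of `α`, `β` stops it takes the role of `β` in `block`.
  block-∃ : ∀ {α β γ} → Coherent α → Coherent β → Coherent γ → ∀ j → α j < γ j → β j < γ j → ∃[ j ] Block α β γ j
  block-∃ cα cβ cγ zero lt _ = ⊥-elim (<⇒≱ lt (subst (_≤ _) (sym (Coherent.base cγ)) z≤n))
  block-∃ {α} {β} {γ} cα cβ cγ (suc k) αj<γj βj<γj with γ k ≤? β k | γ k ≤? α k
  ... | yes γk≤βk | _         = suc k , block-∃-at cα cβ cγ k αj<γj βj<γj γk≤βk
  ... | no _      | yes γk≤αk = suc k , Block-comm (block-∃-at cβ cα cγ k βj<γj αj<γj γk≤αk)
  ... | no γk≰βk  | no γk≰αk  = block-∃ cα cβ cγ k (≰⇒> γk≰αk) (≰⇒> γk≰βk)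

  -- Repeating a block along a period.

  G-low : ∀ α m n {i L} → i ≤ L → G α (m + n * p ^ L) i ≡ G α m i + n * p ^ (L ∸ i)
  G-low α m n {i} {L} i≤L = trans (cong (λ z → _/_ z (p ^ i) {{m^n≢0 p i}}) eq) (/-+ (m + α i) (n * p ^ (L ∸ i))
      (p ^ i) {{m^n≢0 p i}})
    where
    lem : ∀ m n a x y → m + n * (x * y) + a ≡ m + a + n * x * y
    lem = solve-∀
    eq : m + n * p ^ L + α i ≡ m + α i + n * p ^ (L ∸ i) * p ^ i
    eq = trans (cong (λ z → m + n * z + α i) (p^-split i≤L)) (lem m n (α i) _ _)

  Periodic : ℕ → (ℕ → ℕ) → Set
  Periodic L α = ∀ i → α (L + i) ≡ α L + α i * p ^ L

  -- Divide first by `p ^ L`, then by `p ^ i`: by periodicity the second division sees `n + α i`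
  -- together with the carry `G α m L` out of the low block.
  G-high : ∀ α {L} → Periodic L α → ∀ m n i → G α (m + n * p ^ L) (L + i) ≡ _/_ (G α m L + (n + α i))
      (p ^ i) {{m^n≢0 p i}}
  G-high α {L} per m n i = begin
    _/_ (m + n * p ^ L + α (L + i)) (p ^ (L + i)) {{m^n≢0 p
        (L + i)}} ≡⟨ /-congʳ {o = p ^ L * p ^ i} {m = m + n * p ^ L + α (L + i)} {{m^n≢0 p (L + i)}} {{nz}}
        (^-distribˡ-+-* p L i) ⟩
    _/_ (m + n * p ^ L + α (L + i)) (p ^ L * p ^ i) {{nz}} ≡⟨ m/n/o≡m/[n*o] (m + n * p ^ L + α (L + i)) (p ^ L)
        (p ^ i) {{m^n≢0 p L}} {{m^n≢0 p i}} {{nz}} ⟨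
    ((m + n * p ^ L + α (L + i)) /L) /i ≡⟨ cong _/i (trans (cong _/L eq) (/-+ (m + α L) (n + α i)
        (p ^ L) {{m^n≢0 p L}})) ⟩
    (G α m L + (n + α i)) /i ∎
    where
    open ≡-Reasoning
    nz : NonZero (p ^ L * p ^ i)
    nz = m*n≢0 (p ^ L) (p ^ i) {{m^n≢0 p L}} {{m^n≢0 p i}}
    _/L _/i : ℕ → ℕ
    x /L = _/_ x (p ^ L) {{m^n≢0 p L}}
    x /i = _/_ x (p ^ i) {{m^n≢0 p i}}
    lem : ∀ m n x y q → m + n * q + (x + y * q) ≡ m + x + (n + y) * q
    lem = solve-∀
    eq : m + n * p ^ L + α (L + i) ≡ m + α L + (n + α i) * p ^ L
    eq = trans (cong (m + n * p ^ L +_) (per i)) (lem m n (α L) (α i) (p ^ L))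

  G-high-≡ : ∀ α {L} → Periodic L α → ∀ {m} → m + α L < p ^ L → ∀ n i → G α (m + n * p ^ L) (L + i) ≡ G α n i
  G-high-≡ α {L} per {m} lt n i = trans (G-high α per m n i) (cong (λ z → _/_ (z + (n + α i)) (p ^ i) {{m^n≢0 p i}})
      (m<n⇒m/n≡0 {{m^n≢0 p L}} lt))

  -- For `γ` and `𝟎` a lower bound is enough: a carry out of the low block only increases the
  -- denominator's valuation.
  G-high-≥ : ∀ α {L} → Periodic L α → ∀ m n i → G α n i ≤ G α (m + n * p ^ L) (L + i)
  G-high-≥ α {L} per m n i = ≤-trans (/-monoˡ-≤ (p ^ i) {{m^n≢0 p i}} (m≤n+m (n + α i) (G α m L))) (≤-reflexive (sym
      (G-high α per m n i)))

  -- Each round puts `m₀` below the previous `n`: the lowest `L` levels gain at least one, and the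
  -- levels above keep the deficit of `n`. The free `J` allows the cutoff to be chosen after `m`.
  iterate : ∀ {α β γ j L} → Coherent α → Coherent β → Block α β γ j → j ≤ L → Periodic L α → Periodic L β →
      Periodic L γ →
    ∀ N → ∃[ m ] ∀ J → N + ∑ (N * L + J) (λ i → G α m (suc i) + G β m (suc i)) ≤ ∑ (N * L + J) (λ i → G γ m
        (suc i) + G 𝟎 m (suc i))
  iterate {α} {β} {γ} cα cβ B j≤L pα pβ pγ zero = 0 , λ J → ∑-mono J (λ i _ →
    ≤-trans (+-mono-≤ (zer cα (suc i)) (zer cβ (suc i))) z≤n)
    where
    zer : ∀ {δ} → Coherent δ → ∀ i → G δ 0 i ≤ 0
    zer {δ} cδ i = G-upper δ 0 0 i (subst (δ i <_) (sym (+-identityʳ _)) (Coherent.bound cδ i))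
  iterate {α} {β} {γ} {j} {L} cα cβ B j≤L pα pβ pγ (suc N) with iterate cα cβ B j≤L pα pβ pγ N
  ... | n , ih = m , λ J → begin
      suc N + ∑ (L + N * L + J) H                       ≡⟨ cong (λ z → suc N + ∑ z H) (+-assoc L _ J) ⟩
      suc N + ∑ (L + (N * L + J)) H                     ≡⟨ cong (suc N +_) (∑-split L _ H) ⟩
      suc N + (∑ L H + ∑ (N * L + J) (H ∘ (L +_)))      ≡⟨ lem N (∑ L H) _ ⟩
      suc (∑ L H) + (N + ∑ (N * L + J) (H ∘ (L +_)))    ≤⟨ +-mono-≤ low (≤-trans (+-monoʳ-≤ N (∑-mono (N * L + J)
          (λ i _ → Hhigh i))) (≤-trans (ih J) (∑-mono (N * L + J) (λ i _ → Khigh i)))) ⟩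
      ∑ L K + ∑ (N * L + J) (K ∘ (L +_))                ≡⟨ ∑-split L _ K ⟨
      ∑ (L + (N * L + J)) K                             ≡⟨ cong (λ z → ∑ z K) (+-assoc L _ J) ⟨
      ∑ (L + N * L + J) K ∎
    where
    open ≤-Reasoning
    open Block B using (m₀; 1≤j; levels; α-top; β-top) renaming (strict to strict-j)
    m = m₀ + n * p ^ L
    H K : ℕ → ℕ
    H i = G α m (suc i) + G β m (suc i)
    K i = G γ m (suc i) + G 𝟎 m (suc i)
    lem : ∀ N a b → suc N + (a + b) ≡ suc a + (N + b)
    lem = solve-∀
    ex : ∀ a b x → a + x + (b + x) ≡ a + b + (x + x)
    ex = solve-∀
    low-eq : ∀ δ ε i → i ≤ L → G δ m i + G ε m i ≡ G δ m₀ i + G ε m₀ i + (n * p ^ (L ∸ i) + n * p ^ (L ∸ i))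
    low-eq δ ε i i≤L = trans (cong₂ _+_ (G-low δ m₀ n i≤L) (G-low ε m₀ n i≤L)) (ex (G δ m₀ i) (G ε m₀ i) _)
    low≤ : ∀ i → i < L → H i ≤ K i
    low≤ i i<L = subst₂ _≤_ (sym (low-eq α β (suc i) i<L)) (sym (low-eq γ 𝟎 (suc i) i<L)) (+-monoˡ-≤ _ (levels
        (suc i)))
    low : ∑ L H < ∑ L K
    -- Summation index `i` stands for level `suc i`, so level `j` has index `pred j`.
    low = ∑-mono-< L low≤ (pred j) (subst (_≤ L) (sym j≡) j≤L) (subst (λ z → G α m z + G β m z < G γ m z + G 𝟎 m z)
        (sym j≡)
      (subst₂ _<_ (sym (low-eq α β j j≤L)) (sym (low-eq γ 𝟎 j j≤L)) (+-monoˡ-< _ strict-j)))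
      where
      j≡ : suc (pred j) ≡ j
      j≡ = suc-pred j {{>-nonZero 1≤j}}
    shift : ∀ δ i → G δ m (suc (L + i)) ≡ G δ m (L + suc i)
    shift δ i = cong (G δ m) (sym (+-suc L i))
    Hhigh : ∀ i → H (L + i) ≤ G α n (suc i) + G β n (suc i)
    Hhigh i = ≤-reflexive (cong₂ _+_ (trans (shift α i) (G-high-≡ α pα {m₀} (α-top j≤L) n (suc i))) (trans
        (shift β i) (G-high-≡ β pβ {m₀} (β-top j≤L) n (suc i))))
    Khigh : ∀ i → G γ n (suc i) + G 𝟎 n (suc i) ≤ K (L + i)
    Khigh i = +-mono-≤ (≤-trans (G-high-≥ γ pγ m₀ n (suc i)) (≤-reflexive (sym (shift γ i))))
                       (≤-trans (G-high-≥ 𝟎 {L} (λ _ → refl) m₀ n (suc i)) (≤-reflexive (sym (shift 𝟎 i))))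

-- Rational arithmetic and its translation to natural numbers.

module _ where
  open +-*-Solver

  *-regroup-distribʳ : ∀ q a m d e → q ℚ.* (a ℚ.+ m) ℚ.* (d ℚ.* e) ≡ q ℚ.* e ℚ.* (a ℚ.* d ℚ.+ m ℚ.* d)
  *-regroup-distribʳ = solve 5 (λ q a m d e → q :* (a :+ m) :* (d :* e) := q :* e :* (a :* d :+ m :* d)) refl

  *-swap-outer : ∀ x i y e → x ℚ.* i ℚ.* (y ℚ.* e) ≡ i ℚ.* y ℚ.* (x ℚ.* e)
  *-swap-outer = solve 4 (λ x i y e → x :* i :* (y :* e) := i :* y :* (x :* e)) refl

  *-share : ∀ u v e → u ℚ.* v ℚ.* (e ℚ.* e) ≡ u ℚ.* e ℚ.* (v ℚ.* e)
  *-share = solve 3 (λ u v e → u :* v :* (e :* e) := u :* e :* (v :* e)) refl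

  *-distribʳ-shift : ∀ a t d → (a ℚ.- 1ℚ ℚ.- t) ℚ.* d ≡ a ℚ.* d ℚ.- (1ℚ ℚ.+ t) ℚ.* d
  *-distribʳ-shift = solve 3 (λ a t d → (a :- con 1ℚ :- t) :* d := a :* d :- (con 1ℚ :+ t) :* d) refl

  a-[a+n]≡-n : ∀ a n → a ℚ.- (a ℚ.+ n) ≡ ℚ.- n
  a-[a+n]≡-n = solve 2 (λ a n → a :- (a :+ n) := :- n) refl

ι : ℕ → ℚ
ι = ℕtoℚ

toℚᵘ-/1 : ∀ z → toℚᵘ (z ℚ./ 1) ℚᵘ.≃ mkℚᵘ z 0
toℚᵘ-/1 z = ℚ.toℚᵘ-fromℚᵘ (mkℚᵘ z 0)

ι-+ : ∀ m n → ι (m + n) ≡ ι m ℚ.+ ι n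
ι-+ m n = ℚ.toℚᵘ-injective (begin-equality
  toℚᵘ (ι (m + n))              ≃⟨ toℚᵘ-/1 (ℤ.+ (m + n)) ⟩
  mkℚᵘ (ℤ.+ (m + n)) 0            ≃⟨ *≡* (cong (ℤ._* ℤ.+ 1) (cong₂ ℤ._+_ (sym (ℤ.*-identityʳ (ℤ.+ m))) (sym
      (ℤ.*-identityʳ (ℤ.+ n))))) ⟩
  mkℚᵘ (ℤ.+ m) 0 ℚᵘ.+ mkℚᵘ (ℤ.+ n) 0 ≃⟨ ℚᵘ.+-cong (toℚᵘ-/1 (ℤ.+ m)) (toℚᵘ-/1 (ℤ.+ n)) ⟨
  toℚᵘ (ι m) ℚᵘ.+ toℚᵘ (ι n)    ≃⟨ ℚ.toℚᵘ-homo-+ (ι m) (ι n) ⟨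
  toℚᵘ (ι m ℚ.+ ι n)            ∎)
  where open ℚᵘ.≤-Reasoning

ι-* : ∀ m n → ι (m * n) ≡ ι m ℚ.* ι n
ι-* m n = ℚ.toℚᵘ-injective (begin-equality
  toℚᵘ (ι (m * n))              ≃⟨ toℚᵘ-/1 (ℤ.+ (m * n)) ⟩
  mkℚᵘ (ℤ.+ (m * n)) 0            ≃⟨ *≡* (cong (ℤ._* ℤ.+ 1) (ℤ.pos-* m n)) ⟩
  mkℚᵘ (ℤ.+ m) 0 ℚᵘ.* mkℚᵘ (ℤ.+ n) 0 ≃⟨ ℚᵘ.*-cong (toℚᵘ-/1 (ℤ.+ m)) (toℚᵘ-/1 (ℤ.+ n)) ⟨
  toℚᵘ (ι m) ℚᵘ.* toℚᵘ (ι n)    ≃⟨ ℚ.toℚᵘ-homo-* (ι m) (ι n) ⟨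
  toℚᵘ (ι m ℚ.* ι n)            ∎)
  where open ℚᵘ.≤-Reasoning

-- Absolute values discard the sign, which does not affect divisibility by `p`.
cross : ∀ x d z → x ℚ.* ι d ≡ z ℚ./ 1 → ℤ.∣ ℚ.numerator x ∣ * d ≡ ℤ.∣ z ∣ * ℚ.denominatorℕ x
cross x@record{} d z eq = begin
  ℤ.∣ ℚ.numerator x ∣ * d        ≡⟨ ℤ.abs-* (ℚ.numerator x) (ℤ.+ d) ⟨
  ℤ.∣ ℚ.numerator x ℤ.* ℤ.+ d ∣    ≡⟨ cong ℤ.∣_∣ (trans (sym (ℤ.*-identityʳ (ℚ.numerator x ℤ.* ℤ.+ d))) (trans
      (ℚᵘ.drop-*≡* eqᵘ) (cong (λ k → z ℤ.* ℤ.+ k) (*-identityʳ (ℚ.denominatorℕ x))))) ⟩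
  ℤ.∣ z ℤ.* ℚ.denominator x ∣    ≡⟨ ℤ.abs-* z (ℚ.denominator x) ⟩
  ℤ.∣ z ∣ * ℚ.denominatorℕ x     ∎
  where
  open ≡-Reasoning
  eqᵘ : toℚᵘ x ℚᵘ.* mkℚᵘ (ℤ.+ d) 0 ℚᵘ.≃ mkℚᵘ z 0
  eqᵘ = ℚᵘ.≃-trans (ℚᵘ.*-cong (ℚᵘ.≃-refl {toℚᵘ x}) (ℚᵘ.≃-sym (toℚᵘ-/1 (ℤ.+ d))))
    (ℚᵘ.≃-trans (ℚᵘ.≃-sym (ℚ.toℚᵘ-homo-* x (ι d))) (ℚᵘ.≃-trans (ℚ.toℚᵘ-cong eq) (toℚᵘ-/1 z)))

cross⁺ : ∀ x d n → x ℚ.* ι d ≡ ι n → ℤ.∣ ℚ.numerator x ∣ * d ≡ n * ℚ.denominatorℕ x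
cross⁺ x d n = cross x d (ℤ.+ n)

cross⁻ : ∀ x d n → x ℚ.* ι d ≡ ℚ.- ι n → ℤ.∣ ℚ.numerator x ∣ * d ≡ n * ℚ.denominatorℕ x
-- Only after splitting `n` does `ℚ.- ι n` compute to an integer over 1.
cross⁻ x d zero    eq = cross x d (ℤ.+ 0) eq
cross⁻ x d (suc n) eq = cross x d ℤ.-[1+ n ] eq

ι≢0 : ∀ n .{{_ : NonZero n}} → ι n ≢ 0ℚ
ι≢0 n eq = ≢-nonZero⁻¹ n (sym (trans (cross⁺ 0ℚ 1 n (sym eq)) (*-identityʳ n)))

inv-* : ∀ {y} → y ≢ 0ℚ → inv y ℚ.* y ≡ 1ℚ
inv-* {y} y≢0 with y ℚ.≟ 0ℚ
... | yes y≡0 = ⊥-elim (y≢0 y≡0)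
... | no  y≢0 = ℚ.*-inverseˡ y {{ℚ.≢-nonZero y≢0}}

*-ι-denominator : ∀ x → 0ℚ ℚ.< x → x ℚ.* ι (ℚ.denominatorℕ x) ≡ ι (ℤ.∣ ℚ.numerator x ∣)
*-ι-denominator x@record{} 0<x = ℚ.toℚᵘ-injective (begin-equality
  toℚᵘ (x ℚ.* ι d)           ≃⟨ ℚ.toℚᵘ-homo-* x (ι d) ⟩
  toℚᵘ x ℚᵘ.* toℚᵘ (ι d)     ≃⟨ ℚᵘ.*-cong (ℚᵘ.≃-refl {toℚᵘ x}) (toℚᵘ-/1 (ℤ.+ d)) ⟩
  toℚᵘ x ℚᵘ.* mkℚᵘ (ℤ.+ d) 0   ≃⟨ *≡* (trans (ℤ.*-identityʳ _) (cong₂ ℤ._*_ num≡ (cong ℤ.+_ (sym (*-identityʳ d))))) ⟩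
  mkℚᵘ (ℤ.+ n) 0               ≃⟨ toℚᵘ-/1 (ℤ.+ n) ⟨
  toℚᵘ (ι n)                 ∎)
  where
  open ℚᵘ.≤-Reasoning
  d = ℚ.denominatorℕ x
  n = ℤ.∣ ℚ.numerator x ∣
  num≡ : ℚ.numerator x ≡ ℤ.+ n
  num≡ = sym (ℤ.0≤i⇒+∣i∣≡i (ℤ.<⇒≤ (subst (ℤ.+ 0 ℤ.<_) (ℤ.*-identityʳ _) (ℚ.drop-*<* 0<x))))

numerator>0 : ∀ x → 0ℚ ℚ.< x → 0 < ℤ.∣ ℚ.numerator x ∣
numerator>0 (mkℚ (ℤ.+ suc n) _ _)   _   = z<s
numerator>0 (mkℚ (ℤ.+ zero) _ _)    0<x = ⊥-elim (ℤ.<-irrefl refl (ℚ.drop-*<* 0<x))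
numerator>0 (mkℚ ℤ.-[1+ n ] _ _)  _   = z<s

numerator<denominator : ∀ x → 0ℚ ℚ.< x → x ℚ.< 1ℚ → ℤ.∣ ℚ.numerator x ∣ < ℚ.denominatorℕ x
numerator<denominator (mkℚ (ℤ.+ n) d _)       _   x<1 = ℤ.drop‿+<+ (subst₂ ℤ._<_ (ℤ.*-identityʳ (ℤ.+ n))
    (ℤ.*-identityˡ (ℤ.+ suc d)) (ℚ.drop-*<* x<1))
numerator<denominator (mkℚ ℤ.-[1+ n ] d _)  0<x _   = ⊥-elim (ℤ.<-asym (ℚ.drop-*<* 0<x) ℤ.-<+)

-- Pochhammer symbols and coefficients over a common denominator.

-- For a = A / D this is D^m (a)_m; for A = D it is D^m m!.
poch-num : ℕ → ℕ → ℕ → ℕ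
poch-num D A zero    = 1
poch-num D A (suc m) = poch-num D A m * (A + m * D)

poch-num-pos : ∀ D A m → 0 < A → 0 < poch-num D A m
poch-num-pos D A zero    0<A = z<s
poch-num-pos D A (suc m) 0<A = *-mono-< (poch-num-pos D A m 0<A) (<-≤-trans 0<A (m≤m+n A _))

poch-ι : ∀ a D A → a ℚ.* ι D ≡ ι A → ∀ m → poch a m ℚ.* ι (D ^ m) ≡ ι (poch-num D A m)
poch-ι a D A eq zero = refl
poch-ι a D A eq (suc m) = begin
  poch a m ℚ.* (a ℚ.+ ι m) ℚ.* ι (D * D ^ m)                  ≡⟨ cong (poch a m ℚ.* (a ℚ.+ ι m) ℚ.*_) (ι-* D
      (D ^ m)) ⟩
  poch a m ℚ.* (a ℚ.+ ι m) ℚ.* (ι D ℚ.* ι (D ^ m))            ≡⟨ *-regroup-distribʳ (poch a m) a (ι m) (ι D) (ι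
      (D ^ m)) ⟩
  poch a m ℚ.* ι (D ^ m) ℚ.* (a ℚ.* ι D ℚ.+ ι m ℚ.* ι D)      ≡⟨ cong₂ ℚ._*_ (poch-ι a D A eq m) (cong₂ ℚ._+_ eq
      (sym (ι-* m D))) ⟩
  ι (poch-num D A m) ℚ.* (ι A ℚ.+ ι (m * D))                  ≡⟨ cong (ι (poch-num D A m) ℚ.*_) (sym (ι-+ A
      (m * D))) ⟩
  ι (poch-num D A m) ℚ.* ι (A + m * D)                        ≡⟨ sym (ι-* (poch-num D A m) (A + m * D)) ⟩
  ι (poch-num D A m * (A + m * D)) ∎
  where
  open ≡-Reasoning

fact≡poch : ∀ m → fact m ≡ poch 1ℚ m
fact≡poch zero    = refl
fact≡poch (suc m) = cong₂ ℚ._*_ (fact≡poch m) (ι-+ 1 m)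

-- Numerator and denominator each contain two Pochhammer symbols, so the factors `D ^ m` cancel.
-- `0 < C` makes the denominator nonzero, where `inv` is the true inverse.
coeff-ι : ∀ a b c D A B C .{{_ : NonZero D}} → 0 < C → a ℚ.* ι D ≡ ι A → b ℚ.* ι D ≡ ι B → c ℚ.* ι D ≡ ι C → ∀ m →
  coeff a b c m ℚ.* ι (poch-num D C m * poch-num D D m) ≡ ι (poch-num D A m * poch-num D B m)
coeff-ι a b c D A B C 0<C ea eb ec m = begin
  x ℚ.* inv y ℚ.* ι (PC * PD)        ≡⟨ cong (x ℚ.* inv y ℚ.*_) (sym y≡) ⟩
  x ℚ.* inv y ℚ.* (y ℚ.* E)          ≡⟨ *-swap-outer x (inv y) y E ⟩
  inv y ℚ.* y ℚ.* (x ℚ.* E)          ≡⟨ cong₂ ℚ._*_ (inv-* y≢0) (pair (poch a m) (poch b m) PA PB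
      (poch-ι a D A ea m) (poch-ι b D B eb m)) ⟩
  1ℚ ℚ.* ι (PA * PB)                 ≡⟨ ℚ.*-identityˡ (ι (PA * PB)) ⟩
  ι (PA * PB) ∎
  where
  open ≡-Reasoning
  PA = poch-num D A m
  PB = poch-num D B m
  PC = poch-num D C m
  PD = poch-num D D m
  e = ι (D ^ m)
  E = e ℚ.* e
  x = poch a m ℚ.* poch b m
  y = poch c m ℚ.* fact m
  pair : ∀ u v m n → u ℚ.* e ≡ ι m → v ℚ.* e ≡ ι n → u ℚ.* v ℚ.* E ≡ ι (m * n)
  pair u v m n eu ev = trans (*-share u v e) (trans (cong₂ ℚ._*_ eu ev) (sym (ι-* m n)))
  y≡ : y ℚ.* E ≡ ι (PC * PD)
  y≡ = pair (poch c m) (fact m) PC PD (poch-ι c D C ec m) (trans (cong (ℚ._* e) (fact≡poch m)) (poch-ι 1ℚ D D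
      (ℚ.*-identityˡ (ι D)) m))
  y≢0 : y ≢ 0ℚ
  y≢0 eq = ι≢0 (PC * PD) {{>-nonZero (*-mono-< (poch-num-pos D C m 0<C) (poch-num-pos D D m (>-nonZero⁻¹ D)))}}
    (trans (sym y≡) (trans (cong (ℚ._* E) eq) (ℚ.*-zeroˡ E)))

-- Integrality at p as divisibility of natural numbers.

module _ (p : ℕ) (p-prime : Prime p) where
  open Valuation p p-prime

  p∤num∧den : ∀ x → p ∣ ℤ.∣ ℚ.numerator x ∣ → ¬ p ∣ ℚ.denominatorℕ x
  p∤num∧den (mkℚ n d cop) p∣n p∣d = <⇒≢ 1<p (sym (Coprimality.recompute cop (p∣n , p∣d)))

  -- The equation says that `x` is n/d up to sign; `p ^ t` divides the right side, and the reduced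
  -- denominator is prime to `p`.
  PIntegral⇒∣ : ∀ x n d t → ℤ.∣ ℚ.numerator x ∣ * d ≡ n * ℚ.denominatorℕ x → HasVal d t → PIntegral p x → p ^ t ∣ n
  PIntegral⇒∣ x n d t eq (u , refl , _) int = p^∣-cancelʳ int t n (subst (p ^ t ∣_) eq (∣n⇒∣m*n ℤ.∣ ℚ.numerator x ∣
      (m∣m*n u)))

  ∣⇒PIntegral : ∀ x n d t → ℤ.∣ ℚ.numerator x ∣ * d ≡ n * ℚ.denominatorℕ x → HasVal d t → p ^ t ∣ n → PIntegral p x
  ∣⇒PIntegral x _ _ t eq (u , refl , p∤u) (divides v refl) p∣den with euclidsLemma ℤ.∣ ℚ.numerator x ∣ u p-prime
      (subst (p ∣_) (sym num*u) (∣n⇒∣m*n v p∣den))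
    where
    lem₁ : ∀ q m u → q * (m * u) ≡ m * (q * u)
    lem₁ = solve-∀
    lem₂ : ∀ v q d → v * q * d ≡ q * (v * d)
    lem₂ = solve-∀
    num*u : ℤ.∣ ℚ.numerator x ∣ * u ≡ v * ℚ.denominatorℕ x
    num*u = *-cancelˡ-≡ _ _ (p ^ t) {{m^n≢0 p t}} (trans (lem₁ (p ^ t) ℤ.∣ ℚ.numerator x ∣ u) (trans eq (lem₂ v
        (p ^ t) _)))
  ... | inj₁ p∣num = p∤num∧den x p∣num p∣den
  ... | inj₂ p∣u   = p∤u p∣u

  a-1-ι : ∀ a D A t n → a ℚ.* ι D ≡ ι A → A + n ≡ suc t * D → (a ℚ.- 1ℚ ℚ.- ι t) ℚ.* ι D ≡ ℚ.- ι n
  a-1-ι a D A t n ea eq = begin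
    (a ℚ.- 1ℚ ℚ.- ι t) ℚ.* ι D             ≡⟨ *-distribʳ-shift a (ι t) (ι D) ⟩
    a ℚ.* ι D ℚ.- (1ℚ ℚ.+ ι t) ℚ.* ι D     ≡⟨ cong₂ ℚ._-_ ea (trans (cong (ℚ._* ι D) (sym (ι-+ 1 t))) (trans (sym
        (ι-* (suc t) D)) (trans (cong ι (sym eq)) (ι-+ A n)))) ⟩
    ι A ℚ.- (ι A ℚ.+ ι n)                  ≡⟨ a-[a+n]≡-n (ι A) (ι n) ⟩
    ℚ.- ι n ∎
    where
    open ≡-Reasoning

  -- If `p` divided the denominator `d` of `a`, integrality of a - 1 = -(d - n)/d would force `p` to
  -- divide `d ∸ n`, hence also the numerator `n`.
  p∤denominator : ∀ {a} → 0ℚ ℚ.< a → a ℚ.< 1ℚ → PIntegral p (a ℚ.- 1ℚ) → ¬ p ∣ ℚ.denominatorℕ a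
  p∤denominator {a} 0<a a<1 int p∣d = [ (λ h → p∤num∧den a (∣m+n∣m⇒∣n (subst (p ∣_) (sym
      (m∸n+n≡m n≤d)) p∣d) h) p∣d) , int ]′
      (euclidsLemma (d ∸ n) (ℚ.denominatorℕ x) p-prime
        (subst (p ∣_) (cross⁻ x d (d ∸ n) eq) (∣n⇒∣m*n ℤ.∣ ℚ.numerator x ∣ p∣d)))
    where
    d = ℚ.denominatorℕ a
    n = ℤ.∣ ℚ.numerator a ∣
    x = a ℚ.- 1ℚ
    n≤d : n ≤ d
    n≤d = <⇒≤ (numerator<denominator a 0<a a<1)
    eq : x ℚ.* ι d ≡ ℚ.- ι (d ∸ n)
    eq = trans (cong (ℚ._* ι d) (sym (ℚ.+-identityʳ x)))
      (a-1-ι a d n 0 (d ∸ n) (*-ι-denominator a 0<a) (trans (m+[n∸m]≡n n≤d) (sym (+-identityʳ d))))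

  -- Truncations and valuations for parameters with denominator D.

  module Scaled (D : ℕ) .{{_ : NonZero D}} (p∤D : ¬ p ∣ D) where
    open Truncation p p-prime D p∤D
    open Windows p p-prime

    IsTrunc-cross : ∀ {a A} → A ≤ D → a ℚ.* ι D ≡ ι A → ∀ j t →
      let x = (a ℚ.- 1ℚ ℚ.- ι t) ℚ.* inv (ι (p ^ j)) in
      ℤ.∣ ℚ.numerator x ∣ * (p ^ j * D) ≡ (suc t * D ∸ A) * ℚ.denominatorℕ x
    IsTrunc-cross {a} {A} A≤D ea j t = cross⁻ (y ℚ.* inv q) (p ^ j * D) n (begin
      y ℚ.* inv q ℚ.* ι (p ^ j * D)    ≡⟨ cong (y ℚ.* inv q ℚ.*_) (ι-* (p ^ j) D) ⟩
      y ℚ.* inv q ℚ.* (q ℚ.* ι D)      ≡⟨ *-swap-outer y (inv q) q (ι D) ⟩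
      inv q ℚ.* q ℚ.* (y ℚ.* ι D)      ≡⟨ cong₂ ℚ._*_ (inv-* (ι≢0 (p ^ j) {{m^n≢0 p j}})) (a-1-ι a D A t n ea
          (m+[n∸m]≡n (≤-trans A≤D (m≤m+n D (t * D))))) ⟩
      1ℚ ℚ.* (ℚ.- ι n)   ≡⟨ ℚ.*-identityˡ (ℚ.- ι n) ⟩
      ℚ.- ι n ∎)
      where
      open ≡-Reasoning
      y = a ℚ.- 1ℚ ℚ.- ι t
      q = ι (p ^ j)
      n = suc t * D ∸ A

    IsTrunc⇒Trunc : ∀ {a A} → A ≤ D → a ℚ.* ι D ≡ ι A → ∀ j t → IsTrunc p j (a ℚ.- 1ℚ) t → Trunc A j t
    IsTrunc⇒Trunc {a} {A} A≤D ea j t (t< , int) = t< , quotient q∣n ,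
      trans (cong (A +_) (sym (m∣n⇒n≡quotient*m q∣n))) (m+[n∸m]≡n (≤-trans A≤D (m≤m+n D (t * D))))
      where
      q∣n : p ^ j ∣ suc t * D ∸ A
      q∣n = PIntegral⇒∣ ((a ℚ.- 1ℚ ℚ.- ι t) ℚ.* inv (ι (p ^ j))) _ (p ^ j * D) j (IsTrunc-cross {a} A≤D ea j t) (D ,
          refl , p∤D) int

    Trunc⇒IsTrunc : ∀ {a A} → A ≤ D → a ℚ.* ι D ≡ ι A → ∀ j t → Trunc A j t → IsTrunc p j (a ℚ.- 1ℚ) t
    Trunc⇒IsTrunc {a} {A} A≤D ea j t (t< , s , eq) = t< ,
      ∣⇒PIntegral ((a ℚ.- 1ℚ ℚ.- ι t) ℚ.* inv (ι (p ^ j))) _ (p ^ j * D) j (IsTrunc-cross {a} A≤D ea j t) (D ,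
          refl , p∤D)
        (divides s (trans (cong (_∸ A) (sym eq)) (m+n∸m≡n A _)))

    τ : ∀ {A} → 0 < A → A ≤ D → ℕ → ℕ
    τ 0<A A≤D j = proj₁ (trunc-∃ 0<A A≤D j)

    coherent : ∀ {A α} → A ≤ D → (∀ j → Trunc A j (α j)) → Coherent α
    coherent {A} {α} A≤D T = record
      { bound  = λ i → proj₁ (T i)
      ; compat = λ {e} {i} e≤i → _/_ (α i) (p ^ e) {{m^n≢0 p e}} ,
          trans (m≡m%n+[m/n]*n (α i) (p ^ e) {{m^n≢0 p e}}) (cong (_+ _/_ (α i) (p ^ e) {{m^n≢0 p e}} * p ^ e)
              (trunc-unique {A} {e} (trunc-% A≤D e≤i (T i)) (T e)))
      }

    periodic : ∀ {A α L} → 0 < A → A ≤ D → (∀ j → Trunc A j (α j)) → Period L → Periodic L α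
    periodic {A} {α} {L} 0<A A≤D T P i = trunc-unique {A} {L + i} (T (L + i)) (trunc-shift {A} {L} {i} 0<A A≤D P
        (T L) (T i))

    -- Legendre's formula, which is the case `A = D`, for a general progression. The factor
    -- `A + m * D` counts at level `i` exactly when the floor increases. All factors are at most
    -- `m * D` as `A ≤ D`, so levels beyond `J` contribute nothing.
    val-poch-num : ∀ {A α} → 0 < A → A ≤ D → (∀ j → Trunc A j (α j)) → ∀ m J → m * D < p ^ J →
      HasVal (poch-num D A m) (∑ J (λ i → G α m (suc i)))
    val-poch-num {A} {α} 0<A A≤D T zero J _ = subst (HasVal 1)
      (sym (∑-≡0 J (λ i → m<n⇒m/n≡0 {{m^n≢0 p (suc i)}} (proj₁ (T (suc i)))))) (val-p^ 0)
    val-poch-num {A} {α} 0<A A≤D T (suc m) J lt =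
      subst (HasVal (poch-num D A (suc m))) (trans (sym (∑-+ J (λ i → G α m (suc i)) (λ i → indicator∣ (p ^ suc i)
          (A + m * D)))) (∑-cong J (λ i _ → step (suc i))))
        (val-* {k = ∑ J (λ i → G α m (suc i))} {∑ J (λ i → indicator∣ (p ^ suc i) (A + m * D))}
               (val-poch-num 0<A A≤D T m J (≤-<-trans (m≤n+m (m * D) D) lt))
               (val-∑ J (A + m * D) {{>-nonZero (<-≤-trans 0<A (m≤m+n A (m * D)))}} (≤-<-trans (+-monoˡ-≤
                   (m * D) A≤D) lt)))
      where
      step : ∀ i → G α m i + indicator∣ (p ^ i) (A + m * D) ≡ G α (suc m) i
      step i = trans (cong (G α m i +_) (indicator∣-cong (trunc-∣⁻ {A} {i} (T i) m) (trunc-∣ {A} {i} (T i) m))) (sym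
          (suc-/ (m + α i) (p ^ i) {{m^n≢0 p i}}))

    -- The two implications.

    module Parameters (a b c : ℚ) {A B C : ℕ} (0<A : 0 < A) (0<B : 0 < B) (0<C : 0 < C)
      (A≤D : A ≤ D) (B≤D : B ≤ D) (C≤D : C ≤ D)
      (ea : a ℚ.* ι D ≡ ι A) (eb : b ℚ.* ι D ≡ ι B) (ec : c ℚ.* ι D ≡ ι C) where

      α β γ : ℕ → ℕ
      α = τ 0<A A≤D
      β = τ 0<B B≤D
      γ = τ 0<C C≤D

      Tα : ∀ j → Trunc A j (α j)
      Tα j = proj₂ (trunc-∃ 0<A A≤D j)
      Tβ : ∀ j → Trunc B j (β j)
      Tβ j = proj₂ (trunc-∃ 0<B B≤D j)
      Tγ : ∀ j → Trunc C j (γ j)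
      Tγ j = proj₂ (trunc-∃ 0<C C≤D j)

      num den : ℕ → ℕ
      num m = poch-num D A m * poch-num D B m
      den m = poch-num D C m * poch-num D D m

      H K : ℕ → ℕ → ℕ
      H m i = G α m (suc i) + G β m (suc i)
      K m i = G γ m (suc i) + G 𝟎 m (suc i)

      val-num : ∀ m J → m * D < p ^ J → HasVal (num m) (∑ J (H m))
      val-num m J lt = subst (HasVal (num m)) (sym (∑-+ J (λ i → G α m (suc i)) (λ i → G β m (suc i))))
        (val-* {k = ∑ J (λ i → G α m (suc i))} {∑ J (λ i → G β m (suc i))}
          (val-poch-num 0<A A≤D Tα m J lt) (val-poch-num 0<B B≤D Tβ m J lt))

      val-den : ∀ m J → m * D < p ^ J → HasVal (den m) (∑ J (K m))
      val-den m J lt = subst (HasVal (den m)) (sym (∑-+ J (λ i → G γ m (suc i)) (λ i → G 𝟎 m (suc i))))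
        (val-* {k = ∑ J (λ i → G γ m (suc i))} {∑ J (λ i → G 𝟎 m (suc i))}
          (val-poch-num 0<C C≤D Tγ m J lt) (val-poch-num (>-nonZero⁻¹ D) ≤-refl trunc-D m J lt))

      coeff-cross : ∀ k m → let x = ι k ℚ.* coeff a b c m in
        ℤ.∣ ℚ.numerator x ∣ * den m ≡ k * num m * ℚ.denominatorℕ x
      coeff-cross k m = cross⁺ (ι k ℚ.* coeff a b c m) (den m) (k * num m)
        (trans (ℚ.*-assoc (ι k) (coeff a b c m) (ι (den m)))
          (trans (cong (ι k ℚ.*_) (coeff-ι a b c D A B C 0<C ea eb ec m)) (sym (ι-* k (num m)))))

      -- Non-integrality makes some level term of `den m` exceed that of `num m`. There `γ ≤ α`,
      -- together with 0 ≤ `β`, would give the reverse inequality by monotonicity of floors, and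
      -- likewise with `α` and `β` exchanged.
      nonintegral⇒CondI : ∀ m → ¬ PIntegral p (ι 1 ℚ.* coeff a b c m) → CondI p a b c
      nonintegral⇒CondI m ¬int = suc i , α (suc i) , β (suc i) , γ (suc i) ,
          Trunc⇒IsTrunc {a} A≤D ea (suc i) (α (suc i)) (Tα (suc i)) , Trunc⇒IsTrunc {b} B≤D eb (suc i) (β (suc i))
              (Tβ (suc i)) , Trunc⇒IsTrunc {c} C≤D ec (suc i) (γ (suc i)) (Tγ (suc i)) ,
          ≰⇒> (λ γ≤α → <⇒≱ H<K (+-mono-≤ (G-mono γ α γ≤α) (G-mono 𝟎 β z≤n))) ,
          ≰⇒> (λ γ≤β → <⇒≱ H<K (subst (K m i ≤_) (+-comm (G β m (suc i)) (G α m (suc i))) (+-mono-≤ (G-mono γ β γ≤β)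
              (G-mono 𝟎 α z≤n))))
        where
        J = m * D
        lt : m * D < p ^ J
        lt = n<p^n p 1<p J
        v<w : ∑ J (H m) < ∑ J (K m)
        v<w = ≰⇒> (λ w≤v → ¬int (∣⇒PIntegral (ι 1 ℚ.* coeff a b c m) (1 * num m) (den m) (∑ J (K m))
            (coeff-cross 1 m) (val-den m J lt)
          (∣n⇒∣m*n 1 (∣-trans (p^-mono-∣ w≤v) (HasVal⇒∣ {k = ∑ J (H m)} (val-num m J lt))))))
        found = ∑-<⇒∃ J (H m) (K m) v<w
        i = proj₁ found
        H<K : H m i < K m i
        H<K = proj₂ (proj₂ found)
        G-mono : ∀ δ ε → δ (suc i) ≤ ε (suc i) → G δ m (suc i) ≤ G ε m (suc i)
        G-mono δ ε le = /-monoˡ-≤ (p ^ suc i) {{m^n≢0 p (suc i)}} (+-monoʳ-≤ m le)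

      CondI⇒Unbounded : CondI p a b c → Unbounded p (coeff a b c)
      -- Integrality after multiplication by `p ^ N` would give `w ≤ N + v`; iterating the block
      -- `suc N` times gives `suc N + v ≤ w`.
      CondI⇒Unbounded (j , ta , tb , tc , Ta , Tb , Tc , ta<tc , tb<tc) N = m , λ int →
          <⇒≱ (bound (m * D)) (p^∣⇒≤ {k = N + v} {w} (val-* {k = N} {v} (val-p^ N) (val-num m J lt))
            (PIntegral⇒∣ (ι (p ^ N) ℚ.* coeff a b c m) (p ^ N * num m) (den m) w (coeff-cross (p ^ N) m)
                (val-den m J lt) int))
        where
        ta≡ : ta ≡ α j
        ta≡ = trunc-unique {A} {j} (IsTrunc⇒Trunc {a} A≤D ea j ta Ta) (Tα j)
        tb≡ : tb ≡ β j
        tb≡ = trunc-unique {B} {j} (IsTrunc⇒Trunc {b} B≤D eb j tb Tb) (Tβ j)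
        tc≡ : tc ≡ γ j
        tc≡ = trunc-unique {C} {j} (IsTrunc⇒Trunc {c} C≤D ec j tc Tc) (Tγ j)
        cα = coherent A≤D Tα
        cβ = coherent B≤D Tβ
        blk : ∃[ k ] Block α β γ k
        blk = block-∃ cα cβ (coherent C≤D Tγ) j (subst₂ _<_ ta≡ tc≡ ta<tc) (subst₂ _<_ tb≡ tc≡ tb<tc)
        k = proj₁ blk
        per = period-≥ k
        L = proj₁ per
        P = proj₂ (proj₂ per)
        iter = iterate cα cβ (proj₂ blk) (proj₁ (proj₂ per))
          (periodic {A} {α} {L} 0<A A≤D Tα P) (periodic {B} {β} {L} 0<B B≤D Tβ P)
              (periodic {C} {γ} {L} 0<C C≤D Tγ P) (suc N)
        m = proj₁ iter
        bound : ∀ J → suc N + ∑ (suc N * L + J) (H m) ≤ ∑ (suc N * L + J) (K m)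
        bound = proj₂ iter
        -- The first summand covers the repeated blocks, the second makes `p ^ J` exceed `m * D`.
        J = suc N * L + m * D
        v = ∑ J (H m)
        w = ∑ J (K m)
        lt : m * D < p ^ J
        lt = <-≤-trans (n<p^n p 1<p (m * D)) (^-monoʳ-≤ p (m≤n+m (m * D) (suc N * L)))

-- A common denominator for the parameters, and the conclusion.

over-common-denominator : ∀ x → 0ℚ ℚ.< x → x ℚ.< 1ℚ → ∀ {k D} .{{_ : NonZero k}} → D ≡ ℚ.denominatorℕ x * k →
  ∃[ A ] 0 < A × A ≤ D × x ℚ.* ι D ≡ ι A
over-common-denominator x 0<x x<1 {k} refl = n * k , *-mono-< (numerator>0 x 0<x) (>-nonZero⁻¹ k) ,
    *-monoˡ-≤ k (<⇒≤ (numerator<denominator x 0<x x<1)) , (begin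
      x ℚ.* ι (d * k)       ≡⟨ cong (x ℚ.*_) (ι-* d k) ⟩
      x ℚ.* (ι d ℚ.* ι k)   ≡⟨ ℚ.*-assoc x (ι d) (ι k) ⟨
      x ℚ.* ι d ℚ.* ι k     ≡⟨ cong (ℚ._* ι k) (*-ι-denominator x 0<x) ⟩
      ι n ℚ.* ι k           ≡⟨ ι-* n k ⟨
      ι (n * k) ∎)
  where
  open ≡-Reasoning
  n = ℤ.∣ ℚ.numerator x ∣
  d = ℚ.denominatorℕ x

theorem4p2 : (a b c : ℚ) → Admissible a b c → (p : ℕ) → Prime p → Good p a b c →
    (CondI p a b c ⇔ Unbounded p (coeff a b c))
    × (Bounded p (coeff a b c) → ∀ m → PIntegral p (coeff a b c m))
theorem4p2 a b c ((0<a , a<1) , (0<b , b<1) , (0<c , c<1) , _) p p-prime ((_ , ia) , (_ , ib) , (_ , ic)) =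
    -- Unboundedness is used at exponent 0, where `p ^ 0` computes to 1.
    mk⇔ M.CondI⇒Unbounded (λ unb → M.nonintegral⇒CondI (proj₁ (unb 0)) (proj₂ (unb 0))) , bounded⇒integral
  where
  da db dc D : ℕ
  da = ℚ.denominatorℕ a
  db = ℚ.denominatorℕ b
  dc = ℚ.denominatorℕ c
  D = da * (db * dc)
  instance
    dbdc≢0 : NonZero (db * dc)
    dbdc≢0 = m*n≢0 db dc
    dadc≢0 : NonZero (da * dc)
    dadc≢0 = m*n≢0 da dc
    dadb≢0 : NonZero (da * db)
    dadb≢0 = m*n≢0 da db
    D≢0 : NonZero D
    D≢0 = m*n≢0 da (db * dc)
  p∤D : ¬ p ∣ D
  p∤D h = [ p∤denominator p p-prime 0<a a<1 ia , [ p∤denominator p p-prime 0<b b<1 ib ,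
      p∤denominator p p-prime 0<c c<1 ic ]′ ∘ euclidsLemma db dc p-prime ]′
    (euclidsLemma da (db * dc) p-prime h)
  D≡b : D ≡ db * (da * dc)
  D≡b = lem da db dc
    where
    lem : ∀ x y z → x * (y * z) ≡ y * (x * z)
    lem = solve-∀
  D≡c : D ≡ dc * (da * db)
  D≡c = lem da db dc
    where
    lem : ∀ x y z → x * (y * z) ≡ z * (x * y)
    lem = solve-∀
  fa : ∃[ A ] 0 < A × A ≤ D × a ℚ.* ι D ≡ ι A
  fa = over-common-denominator a 0<a a<1 {db * dc} refl
  fb : ∃[ B ] 0 < B × B ≤ D × b ℚ.* ι D ≡ ι B
  fb = over-common-denominator b 0<b b<1 {da * dc} D≡b
  fc : ∃[ C ] 0 < C × C ≤ D × c ℚ.* ι D ≡ ι C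
  fc = over-common-denominator c 0<c c<1 {da * db} D≡c
  module M = Scaled.Parameters p p-prime D p∤D a b c
    (proj₁ (proj₂ fa)) (proj₁ (proj₂ fb)) (proj₁ (proj₂ fc))
    (proj₁ (proj₂ (proj₂ fa))) (proj₁ (proj₂ (proj₂ fb))) (proj₁ (proj₂ (proj₂ fc)))
    (proj₂ (proj₂ (proj₂ fa))) (proj₂ (proj₂ (proj₂ fb))) (proj₂ (proj₂ (proj₂ fc)))

  bounded⇒integral : Bounded p (coeff a b c) → ∀ m → PIntegral p (coeff a b c m)
  -- A single non-integral coefficient gives (i), hence unboundedness, which contradicts the bound
  -- at `N`.
  bounded⇒integral (N , bd) m p∣den = proj₂ unb (bd (proj₁ unb))
    where
    unb : ∃[ m′ ] ¬ PIntegral p (ι (p ^ N) ℚ.* coeff a b c m′)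
    unb = M.CondI⇒Unbounded (M.nonintegral⇒CondI m (λ int → int (subst (λ x → p ∣ ℚ.denominatorℕ x) (sym
        (ℚ.*-identityˡ (coeff a b c m))) p∣den))) N
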